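{- Let $h$ be a fixed positive integer and, for $x\ge 1$, let $$S(x;h)=\sum_{\substack{1\le n\le x\\ n\neq h}} d(n)\,d(n-h)\,d(n+h).$$ Then, as $x\to\infty$, $S(x;h)\ll_h x(\log x)^3$, i.e. there is a constant $C_h>0$ depending only on $h$ with $S(x;h)\le C_h\, x(\log x)^3$ for all sufficiently large $x$.
   Context: For a nonzero integer $m$, $d(m)$ denotes the number of positive divisors of $m$ (so $d(m)=d(|m|)$). The sum is over positive integers $n$. -}

module Defs where

open import Data.Nat using (ℕ; zero; suc; _+_; _*_; ∣_-_∣)
open import Data.Nat.Divisibility using (_∣?_)
open import Data.List using (List; filter; length; map; upTo)
open import Data.Nat.ListAction using (sum)
open import Relation.Nullary using (¬?)
open import Data.Nat using (_≟_)

d : ℕ → ℕ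
d m = length (filter (λ k → k ∣? m) (map suc (upTo m)))

-- the summand d(n) d(n-h) d(n+h); for n ≠ h, d(n-h) = d(|n-h|)
term : ℕ → ℕ → ℕ
term h n = d n * d ∣ n - h ∣ * d (n + h)

S : ℕ → ℕ → ℕ
S x h = sum (map (term h) (filter (λ n → ¬? (n ≟ h)) (map suc (upTo x))))

{-# OPTIONS --safe #-}

-- Fix y = 2^M with y³ ≤ x and log y ≍ log x. For m ≤ 2x one majorises
--   d(m) ≤ ∑ { w(δ) : δ ∣ m, δ < y }
-- with a weight satisfying ∑_{2^i ≤ δ < 2^(i+1)} w(δ) = O(2^i). Since the congruences
-- δ₁ ∣ n, δ₂ ∣ n − h, δ₃ ∣ n + h hold for O_h(x / δ₁δ₂δ₃) values n ≤ x when δ₁δ₂δ₃ ≤ x,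
-- expanding the three majorants and summing dyadically gives O_h(x M³).
--
-- The weight comes from listing the primes of m in increasing order: let b be the longest
-- initial product below y, p the next prime, R = m / b. Then d(m) ≤ d(b) d(R), and
-- d(R) = 2^O(u) with u = log y / log p, since all primes of R are ≥ p. For bounded u a constant
-- weight suffices. Otherwise b ≥ √y, at least half of its divisors are ≥ y^(1/4), and all of
-- them are p-smooth, so a weight 2^O(u) may be placed on the p-smooth δ ≥ y^(1/4); these are
-- so rare (density O_c(2^(-cu)) for every c) that the weight stays bounded on average.
-- For p below a constant 2^K, d(R) ≪ R^(1/K) replaces the bound by the number of prime factors.
--
-- The smooth number bound is Hildebrand-style: count the smooth n < 2^i with weight
-- ∑_{p ∣ n} log p, which is ≫ log n unless n is small or has a large square divisor, then
-- remove p and use ∑_{p < z} log p / p = O(log z).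
module Submission where

open import Defs
open import Data.Nat using (ℕ; zero; suc; pred; 2+; _+_; _*_; _^_; _∸_; _/_; _%_; _≤_; _<_; z≤n; s≤s; z<s; s<s; ∣_-_∣; ⌊_/2⌋; ⌈_/2⌉; NonZero; NonTrivial; >-nonZero; >-nonZero⁻¹; ≢-nonZero; n>1⇒nonTrivial; nonTrivial⇒n>1; _≟_; _≤?_; _<?_)
open import Data.Nat.Properties
open import Data.Nat.Divisibility
open import Data.Nat.DivMod using (m*n/n≡m; m*[n/m]≡n; m≡m%n+[m/n]*n; m%n<n; m/n*n≤m; /-monoˡ-≤; m≥n⇒m/n>0)
open import Data.Nat.GCD using (gcd; gcd[m,n]∣m; gcd[m,n]∣n; gcd[m,n]≢0)
open import Data.Nat.Coprimality using (coprime-/gcd; coprime-divisor)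
open import Data.Nat.Primality
open import Data.Nat.Induction using (<-wellFounded; Acc; acc)
open import Data.Nat.Logarithm using (⌊log₂_⌋; ⌊log₂⌋-mono-≤; ⌊log₂[2^n]⌋≡n; ⌊log₂⌊n/2⌋⌋≡⌊log₂n⌋∸1)
open import Data.Nat.Tactic.RingSolver using (solve-∀)
open import Data.Nat.ListAction using (sum)
open import Data.Nat.ListAction.Properties using (sum-++)
open import Data.List using ([]; _∷_; _++_; _∷ʳ_; filter; length; map; upTo)
open import Data.List.Properties using (upTo-∷ʳ; map-++; filter-++; length-++)
open import Data.Product using (_×_; _,_; proj₁; proj₂; ∃; ∃₂)
open import Data.Sum using (_⊎_; inj₁; inj₂)
open import Data.Empty using (⊥-elim)
open import Function using (_∘_; id)
open import Level using (Level)
open import Relation.Nullary using (Dec; yes; no; ¬_; ¬?; _×-dec_; _→-dec_; contradiction)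
open import Relation.Binary.PropositionalEquality

private
  variable
    ℓ ℓ′ : Level
    P : Set ℓ
    Q : Set ℓ′

-- Finite sums and counting

∑ : ℕ → (ℕ → ℕ) → ℕ
∑ zero    f = 0
∑ (suc n) f = ∑ n f + f n

∑-mono : ∀ n {f g} → (∀ i → i < n → f i ≤ g i) → ∑ n f ≤ ∑ n g
∑-mono zero    f≤g = z≤n
∑-mono (suc n) f≤g =
  +-mono-≤ (∑-mono n λ i i<n → f≤g i (m<n⇒m<1+n i<n)) (f≤g n (n<1+n n))

∑-cong : ∀ n {f g} → (∀ i → f i ≡ g i) → ∑ n f ≡ ∑ n g
∑-cong zero    f≡g = refl
∑-cong (suc n) f≡g = cong₂ _+_ (∑-cong n f≡g) (f≡g n)

∑-+ : ∀ n f g → ∑ n (λ i → f i + g i) ≡ ∑ n f + ∑ n g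
∑-+ zero    f g = refl
∑-+ (suc n) f g rewrite ∑-+ n f g = lemma (∑ n f) (∑ n g) (f n) (g n)
  where
  lemma : ∀ a b c e → a + b + (c + e) ≡ a + c + (b + e)
  lemma = solve-∀

∑-*ˡ : ∀ n c f → ∑ n (λ i → c * f i) ≡ c * ∑ n f
∑-*ˡ zero    c f = sym (*-zeroʳ c)
∑-*ˡ (suc n) c f rewrite ∑-*ˡ n c f = sym (*-distribˡ-+ c (∑ n f) (f n))

∑-*ʳ : ∀ n c f → ∑ n (λ i → f i * c) ≡ ∑ n f * c
∑-*ʳ n c f =
  trans (∑-cong n λ i → *-comm (f i) c) (trans (∑-*ˡ n c f) (*-comm c (∑ n f)))

∑-zero : ∀ n → ∑ n (λ _ → 0) ≡ 0
∑-zero zero    = refl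
∑-zero (suc n) = cong (_+ 0) (∑-zero n)

∑-swap : ∀ m n (f : ℕ → ℕ → ℕ) →
         ∑ m (λ i → ∑ n (f i)) ≡ ∑ n (λ j → ∑ m (λ i → f i j))
∑-swap zero    n f = sym (∑-zero n)
∑-swap (suc m) n f rewrite ∑-swap m n f = sym (∑-+ n (λ j → ∑ m (λ i → f i j)) (f m))

∑-split : ∀ m n f → ∑ (m + n) f ≡ ∑ m f + ∑ n (λ i → f (m + i))
∑-split m zero    f rewrite +-identityʳ m = sym (+-identityʳ (∑ m f))
∑-split m (suc n) f rewrite +-suc m n | ∑-split m n f =
  +-assoc (∑ m f) (∑ n (λ i → f (m + i))) (f (m + n))

∑-range : ∀ {m n} f → m ≤ n → ∑ m f ≤ ∑ n f
∑-range {m} {n} f m≤n = begin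
  ∑ m f                                    ≤⟨ m≤m+n (∑ m f) _ ⟩
  ∑ m f + ∑ (n ∸ m) (λ i → f (m + i))      ≡⟨ ∑-split m (n ∸ m) f ⟨
  ∑ (m + (n ∸ m)) f                        ≡⟨ cong (λ k → ∑ k f) (m+[n∸m]≡n m≤n) ⟩
  ∑ n f                                    ∎
  where open ≤-Reasoning

∑-point : ∀ {i} n f → i < n → f i ≤ ∑ n f
∑-point {i} n f i<n = ≤-trans (m≤n+m (f i) (∑ i f)) (∑-range f i<n)

∑-bounded : ∀ n c {f} → (∀ i → i < n → f i ≤ c) → ∑ n f ≤ n * c
∑-bounded zero    c f≤c = z≤n
∑-bounded (suc n) c f≤c = ≤-trans
  (+-mono-≤ (∑-bounded n c λ i i<n → f≤c i (m<n⇒m<1+n i<n)) (f≤c n (n<1+n n)))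
  (≤-reflexive (+-comm (n * c) c))

∑-const : ∀ n c → ∑ n (λ _ → c) ≡ n * c
∑-const zero    c = refl
∑-const (suc n) c = trans (cong (_+ c) (∑-const n c)) (+-comm (n * c) c)

-- The Iverson bracket: cardinalities are written as sums of `⟦_⟧`, so that double counting becomes
-- an exchange of sums.
⟦_⟧ : Dec P → ℕ
⟦ yes _ ⟧ = 1
⟦ no  _ ⟧ = 0

⟦⟧≤1 : (p? : Dec P) → ⟦ p? ⟧ ≤ 1
⟦⟧≤1 (yes _) = ≤-refl
⟦⟧≤1 (no  _) = z≤n

⟦⟧-yes : (p? : Dec P) → P → ⟦ p? ⟧ ≡ 1
⟦⟧-yes (yes _) _ = refl
⟦⟧-yes (no ¬p) p = contradiction p ¬p

⟦⟧-no : (p? : Dec P) → ¬ P → ⟦ p? ⟧ ≡ 0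
⟦⟧-no (yes p) ¬p = contradiction p ¬p
⟦⟧-no (no _)  _  = refl

⟦⟧-≤ : (p? : Dec P) {a : ℕ} → (P → 1 ≤ a) → ⟦ p? ⟧ ≤ a
⟦⟧-≤ (yes p) h = h p
⟦⟧-≤ (no _)  h = z≤n

⟦⟧-mono : (p? : Dec P) (q? : Dec Q) → (P → Q) → ⟦ p? ⟧ ≤ ⟦ q? ⟧
⟦⟧-mono p? q? f = ⟦⟧-≤ p? λ p → ≤-reflexive (sym (⟦⟧-yes q? (f p)))

⟦⟧*-≤ : (p? : Dec P) {a b : ℕ} → (P → a ≤ b) → ⟦ p? ⟧ * a ≤ b
⟦⟧*-≤ (yes p) {a} h = ≤-trans (≤-reflexive (*-identityˡ a)) (h p)
⟦⟧*-≤ (no _)      h = z≤n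

⟦⟧-× : (p? : Dec P) (q? : Dec Q) → ⟦ p? ×-dec q? ⟧ ≡ ⟦ p? ⟧ * ⟦ q? ⟧
⟦⟧-× (yes _) (yes _) = refl
⟦⟧-× (yes _) (no _)  = refl
⟦⟧-× (no _)  (yes _) = refl
⟦⟧-× (no _)  (no _)  = refl

∑-⟦≡⟧*≤ : ∀ n a (f : ℕ → ℕ) → ∑ n (λ i → ⟦ i ≟ a ⟧ * f i) ≤ f a
∑-⟦≡⟧*≤ n a f = go n
  where
  below : ∀ n → n ≤ a → ∑ n (λ i → ⟦ i ≟ a ⟧ * f i) ≤ 0
  below n n≤a = ≤-trans
    (∑-bounded n 0 λ i i<n → ⟦⟧*-≤ (i ≟ a) λ i≡a → ⊥-elim (<⇒≢ (<-≤-trans i<n n≤a) i≡a))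
    (≤-reflexive (*-zeroʳ n))
  go : ∀ n → ∑ n (λ i → ⟦ i ≟ a ⟧ * f i) ≤ f a
  go zero    = z≤n
  go (suc n) with n ≟ a
  ... | yes refl = +-mono-≤ (below n ≤-refl) (≤-reflexive (*-identityˡ (f n)))
  ... | no _     = ≤-trans (≤-reflexive (+-identityʳ _)) (go n)

∑-⟦≡⟧≤1 : ∀ n a → ∑ n (λ i → ⟦ i ≟ a ⟧) ≤ 1
∑-⟦≡⟧≤1 n a = ≤-trans
  (≤-reflexive (∑-cong n λ i → sym (*-identityʳ ⟦ i ≟ a ⟧))) (∑-⟦≡⟧*≤ n a (λ _ → 1))

-- Double counting of the pairs (n , m) with n ≡ φ m.
count-surj : ∀ {p q} {P : ℕ → Set p} {Q : ℕ → Set q}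
  (P? : ∀ n → Dec (P n)) (Q? : ∀ n → Dec (Q n)) (φ : ℕ → ℕ) N N′ →
  (∀ n → n < N → P n → ∃ λ m → m < N′ × Q m × n ≡ φ m) →
  ∑ N (λ n → ⟦ P? n ⟧) ≤ ∑ N′ (λ m → ⟦ Q? m ⟧)
count-surj P? Q? φ N N′ surj = begin
  ∑ N (λ n → ⟦ P? n ⟧)
    ≤⟨ ∑-mono N (λ n n<N → ⟦⟧-≤ (P? n) λ Pn → hit n (surj n n<N Pn)) ⟩
  ∑ N (λ n → ∑ N′ (λ m → ⟦ Q? m ⟧ * ⟦ n ≟ φ m ⟧))
    ≡⟨ ∑-swap N N′ _ ⟩
  ∑ N′ (λ m → ∑ N (λ n → ⟦ Q? m ⟧ * ⟦ n ≟ φ m ⟧))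
    ≡⟨ ∑-cong N′ (λ m → ∑-*ˡ N ⟦ Q? m ⟧ (λ n → ⟦ n ≟ φ m ⟧)) ⟩
  ∑ N′ (λ m → ⟦ Q? m ⟧ * ∑ N (λ n → ⟦ n ≟ φ m ⟧))
    ≤⟨ ∑-mono N′ (λ m _ → ≤-trans (*-monoʳ-≤ ⟦ Q? m ⟧ (∑-⟦≡⟧≤1 N (φ m)))
                                  (≤-reflexive (*-identityʳ _))) ⟩
  ∑ N′ (λ m → ⟦ Q? m ⟧) ∎
  where
  open ≤-Reasoning
  hit : ∀ n → (∃ λ m → m < N′ × _ × n ≡ φ m) →
        1 ≤ ∑ N′ (λ m → ⟦ Q? m ⟧ * ⟦ n ≟ φ m ⟧)
  hit n (m , m<N′ , Qm , n≡) = ≤-trans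
    (≤-reflexive (sym (cong₂ _*_ (⟦⟧-yes (Q? m) Qm) (⟦⟧-yes (n ≟ φ m) n≡))))
    (∑-point N′ (λ m → ⟦ Q? m ⟧ * ⟦ n ≟ φ m ⟧) m<N′)

2^-nonZero : ∀ n → NonZero (2 ^ n)
2^-nonZero n = m^n≢0 2 n

2^-double : ∀ n → 2 ^ suc n ≡ 2 ^ n + 2 ^ n
2^-double n = cong (2 ^ n +_) (+-identityʳ (2 ^ n))

∑-dyadic : ∀ M f →
  ∑ (2 ^ M) f ≡ f 0 + ∑ M (λ i → ∑ (2 ^ i) (λ r → f (2 ^ i + r)))
∑-dyadic zero    f = +-comm 0 (f 0)
∑-dyadic (suc M) f rewrite +-identityʳ (2 ^ M) | ∑-split (2 ^ M) (2 ^ M) f | ∑-dyadic M f =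
  +-assoc (f 0) _ _

-- The hypothesis on f is f δ ≤ X / δ, cleared of denominators.
∑-harmonic : ∀ M C X (w f : ℕ → ℕ) →
  (∀ i → i < M → ∑ (2 ^ i) (λ r → w (2 ^ i + r)) ≤ C * 2 ^ i) →
  w 0 * f 0 ≡ 0 →
  (∀ δ → δ < 2 ^ M → f δ * δ ≤ X) →
  ∑ (2 ^ M) (λ δ → w δ * f δ) ≤ M * (C * X)
∑-harmonic M C X w f w-block wf0 fδ≤X = begin
  ∑ (2 ^ M) (λ δ → w δ * f δ)
    ≡⟨ ∑-dyadic M (λ δ → w δ * f δ) ⟩
  w 0 * f 0 + ∑ M (λ i → ∑ (2 ^ i) (λ r → w (2 ^ i + r) * f (2 ^ i + r)))
    ≡⟨ cong (_+ ∑ M (λ i → ∑ (2 ^ i) (λ r → w (2 ^ i + r) * f (2 ^ i + r)))) wf0 ⟩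
  ∑ M (λ i → ∑ (2 ^ i) (λ r → w (2 ^ i + r) * f (2 ^ i + r)))
    ≤⟨ ∑-bounded M (C * X) block ⟩
  M * (C * X) ∎
  where
  open ≤-Reasoning
  block : ∀ i → i < M → ∑ (2 ^ i) (λ r → w (2 ^ i + r) * f (2 ^ i + r)) ≤ C * X
  -- On this block δ ≥ 2^i, so f δ · 2^i ≤ f δ · δ ≤ X; with total weight at most C · 2^i, the block
  -- contributes at most C X.
  block i i<M = *-cancelʳ-≤ _ _ (2 ^ i) {{2^-nonZero i}} (begin
    ∑ (2 ^ i) (λ r → w (2 ^ i + r) * f (2 ^ i + r)) * 2 ^ i
      ≡⟨ ∑-*ʳ (2 ^ i) (2 ^ i) _ ⟨
    ∑ (2 ^ i) (λ r → w (2 ^ i + r) * f (2 ^ i + r) * 2 ^ i)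
      ≤⟨ ∑-mono (2 ^ i) (λ r r< → begin
           w (2 ^ i + r) * f (2 ^ i + r) * 2 ^ i    ≡⟨ *-assoc (w (2 ^ i + r)) _ _ ⟩
           w (2 ^ i + r) * (f (2 ^ i + r) * 2 ^ i)
             ≤⟨ *-monoʳ-≤ (w (2 ^ i + r)) (*-monoʳ-≤ (f (2 ^ i + r)) (m≤m+n (2 ^ i) r)) ⟩
           w (2 ^ i + r) * (f (2 ^ i + r) * (2 ^ i + r))
             ≤⟨ *-monoʳ-≤ (w (2 ^ i + r)) (fδ≤X (2 ^ i + r) (small r r<)) ⟩
           w (2 ^ i + r) * X ∎) ⟩
    ∑ (2 ^ i) (λ r → w (2 ^ i + r) * X)
      ≡⟨ ∑-*ʳ (2 ^ i) X _ ⟩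
    ∑ (2 ^ i) (λ r → w (2 ^ i + r)) * X
      ≤⟨ *-monoˡ-≤ X (w-block i i<M) ⟩
    C * 2 ^ i * X
      ≡⟨ *-assoc C (2 ^ i) X ⟩
    C * (2 ^ i * X)
      ≡⟨ cong (C *_) (*-comm (2 ^ i) X) ⟩
    C * (X * 2 ^ i)
      ≡⟨ *-assoc C X (2 ^ i) ⟨
    C * X * 2 ^ i ∎)
    where
    small : ∀ r → r < 2 ^ i → 2 ^ i + r < 2 ^ M
    small r r< = begin-strict
      2 ^ i + r     <⟨ +-monoʳ-< (2 ^ i) r< ⟩
      2 ^ i + 2 ^ i ≡⟨ 2^-double i ⟨
      2 ^ suc i     ≤⟨ ^-monoʳ-≤ 2 i<M ⟩
      2 ^ M         ∎

-- The geometric series of the X / 2^t, cleared of denominators. The induction needs the sharper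
-- bound 2X(1 - 2^(-n)), hence the extra `2 * X` on the left in `go`.
∑-geometric : ∀ n X f → (∀ t → t < n → f t * 2 ^ t ≤ X) → ∑ n f ≤ 2 * X
∑-geometric n X f f≤ = *-cancelʳ-≤ _ _ (2 ^ n) {{2^-nonZero n}}
  (≤-trans (m≤m+n _ (2 * X)) (go n f≤))
  where
  open ≤-Reasoning
  ident₁ : ∀ s y p X → (s + y) * (p + p) + (X + X) ≡ (s * p + (X + X)) + (s * p + (y * p + y * p))
  ident₁ = solve-∀
  ident₂ : ∀ p X → 2 * X * p + (2 * X * p) ≡ 2 * X * (p + p)
  ident₂ = solve-∀
  go : ∀ n → (∀ t → t < n → f t * 2 ^ t ≤ X) → ∑ n f * 2 ^ n + 2 * X ≤ 2 * X * 2 ^ n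
  go zero    _  = ≤-reflexive (sym (*-identityʳ (2 * X)))
  go (suc n) f≤ = begin
    (∑ n f + f n) * 2 ^ suc n + 2 * X
      ≡⟨ cong₂ (λ a b → (∑ n f + f n) * a + b) (2^-double n) (cong (X +_) (+-identityʳ X)) ⟩
    (∑ n f + f n) * (2 ^ n + 2 ^ n) + (X + X)
      ≡⟨ ident₁ (∑ n f) (f n) (2 ^ n) X ⟩
    (∑ n f * 2 ^ n + (X + X)) + (∑ n f * 2 ^ n + (f n * 2 ^ n + f n * 2 ^ n))
      ≤⟨ +-monoʳ-≤ (∑ n f * 2 ^ n + (X + X))
           (+-monoʳ-≤ (∑ n f * 2 ^ n) (+-mono-≤ (f≤ n (n<1+n n)) (f≤ n (n<1+n n)))) ⟩
    (∑ n f * 2 ^ n + (X + X)) + (∑ n f * 2 ^ n + (X + X))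
      ≤⟨ +-mono-≤ ih ih ⟩
    2 * X * 2 ^ n + 2 * X * 2 ^ n
      ≡⟨ ident₂ (2 ^ n) X ⟩
    2 * X * (2 ^ n + 2 ^ n)
      ≡⟨ cong (2 * X *_) (2^-double n) ⟨
    2 * X * 2 ^ suc n ∎
    where
    ih : ∑ n f * 2 ^ n + (X + X) ≤ 2 * X * 2 ^ n
    ih = ≤-trans (≤-reflexive (cong (∑ n f * 2 ^ n +_) (cong (X +_) (sym (+-identityʳ X)))))
                 (go n λ t t<n → f≤ t (m<n⇒m<1+n t<n))

-- The divisor function

prime>1 : ∀ {p} → Prime p → 2 ≤ p
prime>1 {p} pp = nonTrivial⇒n>1 p {{prime⇒nonTrivial pp}}

∣⇒>0 : ∀ {m n} → 0 < n → m ∣ n → 0 < m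
∣⇒>0 {zero}  0<n 0∣n = contradiction (0∣⇒≡0 0∣n) (>⇒≢ 0<n)
∣⇒>0 {suc m} _   _   = z<s

cofactor>0 : ∀ a {b n} → 0 < n → n ≡ a * b → 0 < b
cofactor>0 a 0<n n≡ab = ∣⇒>0 0<n (divides a n≡ab)

length-filter-suc-upTo : ∀ {p} {P : ℕ → Set p} (P? : ∀ n → Dec (P n)) m →
  length (filter P? (map suc (upTo m))) ≡ ∑ m (λ k → ⟦ P? (suc k) ⟧)
length-filter-suc-upTo P? zero    = refl
length-filter-suc-upTo P? (suc m) = begin
  length (filter P? (map suc (upTo (suc m))))
    ≡⟨ cong (length ∘ filter P? ∘ map suc) (sym (upTo-∷ʳ m)) ⟩
  length (filter P? (map suc (upTo m ∷ʳ m)))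
    ≡⟨ cong (length ∘ filter P?) (map-++ suc (upTo m) _) ⟩
  length (filter P? (map suc (upTo m) ∷ʳ suc m))
    ≡⟨ cong length (filter-++ P? (map suc (upTo m)) _) ⟩
  length (filter P? (map suc (upTo m)) ++ filter P? (suc m ∷ []))
    ≡⟨ length-++ (filter P? (map suc (upTo m))) ⟩
  length (filter P? (map suc (upTo m))) + length (filter P? (suc m ∷ []))
    ≡⟨ cong₂ _+_ (length-filter-suc-upTo P? m) singleton ⟩
  ∑ m (λ k → ⟦ P? (suc k) ⟧) + ⟦ P? (suc m) ⟧ ∎
  where
  open ≡-Reasoning
  singleton : length (filter P? (suc m ∷ [])) ≡ ⟦ P? (suc m) ⟧
  singleton with P? (suc m)
  ... | yes _ = refl
  ... | no  _ = refl

∑-suc : ∀ m f → ∑ (suc m) f ≡ f 0 + ∑ m (f ∘ suc)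
∑-suc m f = ∑-split 1 m f

d-∑ : ∀ {m} → 0 < m → d m ≡ ∑ (suc m) (λ k → ⟦ k ∣? m ⟧)
d-∑ {m} 0<m = begin
  d m                                            ≡⟨ length-filter-suc-upTo (_∣? m) m ⟩
  ∑ m (λ k → ⟦ suc k ∣? m ⟧)                     ≡⟨ cong (_+ ∑ m (λ k → ⟦ suc k ∣? m ⟧))
                                                     (⟦⟧-no (0 ∣? m) λ 0∣m → <⇒≢ 0<m (sym (0∣⇒≡0 0∣m))) ⟨
  ⟦ 0 ∣? m ⟧ + ∑ m (λ k → ⟦ suc k ∣? m ⟧)        ≡⟨ ∑-suc m (λ k → ⟦ k ∣? m ⟧) ⟨
  ∑ (suc m) (λ k → ⟦ k ∣? m ⟧)                   ∎
  where open ≡-Reasoning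

d-≤-∑ : ∀ {m N} → 0 < m → m < N → d m ≤ ∑ N (λ k → ⟦ k ∣? m ⟧)
d-≤-∑ {m} 0<m m<N =
  ≤-trans (≤-reflexive (d-∑ 0<m)) (∑-range (λ k → ⟦ k ∣? m ⟧) m<N)

-- The choice g = gcd(e, a) works: e / g is coprime to a / g and divides (a / g) b, hence divides b.
∣*-split : ∀ {e} a b → 0 < a → e ∣ a * b → ∃₂ λ g f → g ∣ a × f ∣ b × e ≡ g * f
∣*-split {e} a b 0<a e∣ab = g , f , gcd[m,n]∣n e a , f∣b , e≡gf
  where
  g : ℕ
  g = gcd e a
  instance
    g≢0 : NonZero g
    g≢0 = ≢-nonZero (gcd[m,n]≢0 e a (inj₂ (>⇒≢ 0<a)))
  f a′ : ℕ
  f = e / g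
  a′ = a / g
  e≡gf : e ≡ g * f
  e≡gf = sym (m*[n/m]≡n (gcd[m,n]∣m e a))
  a≡ga′ : a ≡ g * a′
  a≡ga′ = sym (m*[n/m]≡n (gcd[m,n]∣n e a))
  f∣b : f ∣ b
  f∣b = coprime-divisor (coprime-/gcd e a) (*-cancelˡ-∣ g
    (subst₂ _∣_ e≡gf (trans (cong (_* b) a≡ga′) (*-assoc g a′ b)) e∣ab))

-- By `∣*-split` the products g f with g ∣ a and f ∣ b cover all divisors of a b, possibly more than
-- once.
d-submultiplicative : ∀ {a b} → 0 < a → 0 < b → d (a * b) ≤ d a * d b
d-submultiplicative {a} {b} 0<a 0<b = begin
  d (a * b)
    ≡⟨ d-∑ (*-mono-< 0<a 0<b) ⟩
  ∑ N (λ e → ⟦ e ∣? a * b ⟧)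
    ≤⟨ ∑-mono N (λ e _ → ⟦⟧-≤ (e ∣? a * b) (hit e)) ⟩
  ∑ N (λ e → ∑ (suc a) λ g → ∑ (suc b) λ f → F g f * ⟦ e ≟ g * f ⟧)
    ≡⟨ ∑-swap N (suc a) _ ⟩
  ∑ (suc a) (λ g → ∑ N λ e → ∑ (suc b) λ f → F g f * ⟦ e ≟ g * f ⟧)
    ≡⟨ ∑-cong (suc a) (λ g → ∑-swap N (suc b) _) ⟩
  ∑ (suc a) (λ g → ∑ (suc b) λ f → ∑ N λ e → F g f * ⟦ e ≟ g * f ⟧)
    ≤⟨ ∑-mono (suc a) (λ g _ → ∑-mono (suc b) λ f _ → once g f) ⟩
  ∑ (suc a) (λ g → ∑ (suc b) λ f → ⟦ g ∣? a ⟧ * ⟦ f ∣? b ⟧)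
    ≡⟨ ∑-cong (suc a) (λ g → ∑-*ˡ (suc b) ⟦ g ∣? a ⟧ _) ⟩
  ∑ (suc a) (λ g → ⟦ g ∣? a ⟧ * ∑ (suc b) λ f → ⟦ f ∣? b ⟧)
    ≡⟨ ∑-*ʳ (suc a) _ _ ⟩
  ∑ (suc a) (λ g → ⟦ g ∣? a ⟧) * ∑ (suc b) (λ f → ⟦ f ∣? b ⟧)
    ≡⟨ cong₂ _*_ (d-∑ 0<a) (d-∑ 0<b) ⟨
  d a * d b ∎
  where
  open ≤-Reasoning
  N : ℕ
  N = suc (a * b)
  F : ℕ → ℕ → ℕ
  F g f = ⟦ g ∣? a ⟧ * ⟦ f ∣? b ⟧
  once : ∀ g f → ∑ N (λ e → F g f * ⟦ e ≟ g * f ⟧) ≤ F g f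
  once g f = begin
    ∑ N (λ e → F g f * ⟦ e ≟ g * f ⟧) ≡⟨ ∑-*ˡ N (F g f) _ ⟩
    F g f * ∑ N (λ e → ⟦ e ≟ g * f ⟧) ≤⟨ *-monoʳ-≤ (F g f) (∑-⟦≡⟧≤1 N (g * f)) ⟩
    F g f * 1                         ≡⟨ *-identityʳ (F g f) ⟩
    F g f                             ∎
  hit : ∀ e → e ∣ a * b → 1 ≤ ∑ (suc a) (λ g → ∑ (suc b) λ f → F g f * ⟦ e ≟ g * f ⟧)
  hit e e∣ab with ∣*-split a b 0<a e∣ab
  ... | g , f , g∣a , f∣b , e≡gf = begin
    1                               ≡⟨ cong₂ _*_ (cong₂ _*_ (⟦⟧-yes (g ∣? a) g∣a) (⟦⟧-yes (f ∣? b) f∣b))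
                                                 (⟦⟧-yes (e ≟ g * f) e≡gf) ⟨
    F g f * ⟦ e ≟ g * f ⟧           ≤⟨ ∑-point (suc b) (λ f → F g f * ⟦ e ≟ g * f ⟧)
                                         (s≤s (∣⇒≤ {{>-nonZero 0<b}} f∣b)) ⟩
    ∑ (suc b) (λ f → F g f * ⟦ e ≟ g * f ⟧)
                                    ≤⟨ ∑-point (suc a) (λ g → ∑ (suc b) λ f → F g f * ⟦ e ≟ g * f ⟧)
                                         (s≤s (∣⇒≤ {{>-nonZero 0<a}} g∣a)) ⟩
    _ ∎

∣p^⇒≡p^ : ∀ {p} → Prime p → ∀ a {e} → e ∣ p ^ a → ∃ λ i → i < suc a × e ≡ p ^ i
∣p^⇒≡p^ pp zero    e∣1 = 0 , z<s , ∣1⇒≡1 e∣1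
∣p^⇒≡p^ {p} pp (suc a) e∣pp^a
  with ∣*-split p (p ^ a) (<-trans z<s (prime>1 pp)) e∣pp^a
... | g , f , g∣p , f∣p^a , e≡gf with prime⇒irreducible pp g∣p | ∣p^⇒≡p^ pp a f∣p^a
...   | inj₁ refl | i , i< , refl = i , m<n⇒m<1+n i< , trans e≡gf (*-identityˡ _)
...   | inj₂ refl | i , i< , refl = suc i , s<s i< , e≡gf

d[p^a]≤1+a : ∀ {p} → Prime p → ∀ a → d (p ^ a) ≤ suc a
d[p^a]≤1+a {p} pp a = begin
  d (p ^ a)                                    ≡⟨ d-∑ (m^n>0 p {{prime⇒nonZero pp}} a) ⟩
  ∑ (suc (p ^ a)) (λ e → ⟦ e ∣? p ^ a ⟧)       ≤⟨ count-surj (_∣? p ^ a) (λ i → i <? suc a) (p ^_) (suc (p ^ a)) (suc a)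
                                                    (λ e _ e∣ → let i , i< , e≡ = ∣p^⇒≡p^ pp a e∣ in i , i< , i< , e≡) ⟩
  ∑ (suc a) (λ i → ⟦ i <? suc a ⟧)             ≤⟨ ∑-bounded (suc a) 1 (λ i _ → ⟦⟧≤1 (i <? suc a)) ⟩
  suc a * 1                                    ≡⟨ *-identityʳ (suc a) ⟩
  suc a                                        ∎
  where open ≤-Reasoning

-- Trial division: while n is `k Rough`, the first k that divides n is prime and no prime factor is
-- smaller. The fuel n - 2 lets k reach n itself.
least-prime-factor : ∀ n → 2 ≤ n →
  ∃ λ p → Prime p × p ∣ n × (∀ q → Prime q → q ∣ n → p ≤ q)
least-prime-factor n 2≤n = search (n ∸ 2) 2 ≤-refl (≤-reflexive (sym (m+[n∸m]≡n 2≤n))) 2-rough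
  where
  instance
    _ : NonTrivial n
    _ = n>1⇒nonTrivial 2≤n
  search : ∀ fuel k → 2 ≤ k → n ≤ k + fuel → k Rough n →
           ∃ λ p → Prime p × p ∣ n × (∀ q → Prime q → q ∣ n → p ≤ q)
  search fuel k 2≤k n≤ rough with k ∣? n
  ... | yes k∣n = k , rough∧∣⇒prime {{n>1⇒nonTrivial 2≤k}} rough k∣n , k∣n
                , λ q pq q∣n → rough⇒≤ {{prime⇒nonTrivial pq}} (rough∧∣⇒rough rough q∣n)
  search zero k 2≤k n≤ rough | no k∤n =
    contradiction (∣-reflexive (≤-antisym (rough⇒≤ rough) (≤-trans n≤ (≤-reflexive (+-identityʳ k))))) k∤n
  search (suc fuel) k 2≤k n≤ rough | no k∤n =
    search fuel (suc k) (m≤n⇒m≤1+n 2≤k) (≤-trans n≤ (≤-reflexive (+-suc k fuel))) (∤⇒rough-suc k∤n rough)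

-- The induction hypothesis covers all m < p n and not just n, since `large-square-divisor` strips
-- two factors p at once.
prime-induction : ∀ {a} (A : ℕ → Set a) → A 1 →
  (∀ p n → Prime p → 0 < n → (∀ m → 0 < m → m < p * n → A m) → A (p * n)) →
  ∀ n → 0 < n → A n
prime-induction A A1 step n 0<n = go n (<-wellFounded n) 0<n
  where
  go : ∀ n → Acc _<_ n → 0 < n → A n
  go 1 _ _ = A1
  go n@(2+ _) (acc rs) 0<n with least-prime-factor n (s≤s (s≤s z≤n))
  ... | p , pp , divides q n≡qp , _ = subst A (sym n≡pq)
    (step p q pp (cofactor>0 p 0<n n≡pq)
      λ m 0<m m<pq → go m (rs (subst (m <_) (sym n≡pq) m<pq)) 0<m)
    where
    n≡pq : n ≡ p * q
    n≡pq = trans n≡qp (*-comm q p)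

m<p*m : ∀ {p m} → Prime p → 0 < m → m < p * m
m<p*m {p} {m} pp 0<m = subst (_< p * m) (*-identityˡ m) (*-monoˡ-< m {{>-nonZero 0<m}} (prime>1 pp))

PrimesFrom : ℕ → ℕ → Set
PrimesFrom t n = ∀ p → Prime p → p ∣ n → t ≤ p

*-^-distrib : ∀ a b n → (a * b) ^ n ≡ a ^ n * b ^ n
*-^-distrib a b zero    = refl
*-^-distrib a b (suc n) rewrite *-^-distrib a b n = lemma a b (a ^ n) (b ^ n)
  where
  lemma : ∀ a b x y → a * b * (x * y) ≡ a * x * (b * y)
  lemma = solve-∀

-- A further prime p multiplies d by at most d(p) ≤ 2, and 2^q ≤ p. This gives d(R) ≤ R^(1/q) for
-- rough R.
d^q≤n : ∀ q n → 0 < n → PrimesFrom (2 ^ q) n → d n ^ q ≤ n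
d^q≤n q = prime-induction (λ n → PrimesFrom (2 ^ q) n → d n ^ q ≤ n)
  (λ _ → ≤-reflexive (^-zeroˡ q)) step
  where
  open ≤-Reasoning
  step : ∀ p n → Prime p → 0 < n →
         (∀ m → 0 < m → m < p * n → PrimesFrom (2 ^ q) m → d m ^ q ≤ m) →
         PrimesFrom (2 ^ q) (p * n) → d (p * n) ^ q ≤ p * n
  step p n pp 0<n ih from = begin
    d (p * n) ^ q     ≤⟨ ^-monoˡ-≤ q (d-submultiplicative (<-trans z<s (prime>1 pp)) 0<n) ⟩
    (d p * d n) ^ q   ≡⟨ *-^-distrib (d p) (d n) q ⟩
    d p ^ q * d n ^ q ≤⟨ *-mono-≤ (≤-trans (^-monoˡ-≤ q d[p]≤2) (from p pp (m∣m*n n)))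
                           (ih n 0<n (m<p*m pp 0<n) λ r pr r∣n → from r pr (∣n⇒∣m*n p r∣n)) ⟩
    p * n             ∎
    where
    d[p]≤2 : d p ≤ 2
    d[p]≤2 = subst (λ x → d x ≤ 2) (^-identityʳ p) (d[p^a]≤1+a pp 1)

1+n≤2^n : ∀ n → suc n ≤ 2 ^ n
1+n≤2^n zero    = ≤-refl
1+n≤2^n (suc n) = ≤-trans (+-mono-≤ (m^n>0 2 n) (1+n≤2^n n)) (≤-reflexive (sym (2^-double n)))

-- a + 1 ≤ K (⌊a/K⌋ + 1) ≤ K 2^⌊a/K⌋
polynomial≤exponential : ∀ K → .{{NonZero K}} → ∀ a → suc a ^ K ≤ K ^ K * 2 ^ a
polynomial≤exponential K a = begin
  suc a ^ K                 ≤⟨ ^-monoˡ-≤ K 1+a≤ ⟩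
  (K * 2 ^ (a / K)) ^ K     ≡⟨ *-^-distrib K (2 ^ (a / K)) K ⟩
  K ^ K * (2 ^ (a / K)) ^ K ≡⟨ cong (K ^ K *_) (^-*-assoc 2 (a / K) K) ⟩
  K ^ K * 2 ^ (a / K * K)   ≤⟨ *-monoʳ-≤ (K ^ K) (^-monoʳ-≤ 2 (m/n*n≤m a K)) ⟩
  K ^ K * 2 ^ a             ∎
  where
  open ≤-Reasoning
  1+a≤ : suc a ≤ K * 2 ^ (a / K)
  1+a≤ = begin
    suc a                     ≡⟨ cong suc (m≡m%n+[m/n]*n a K) ⟩
    suc (a % K) + a / K * K    ≤⟨ +-monoˡ-≤ (a / K * K) (m%n<n a K) ⟩
    K + a / K * K             ≡⟨ *-comm (suc (a / K)) K ⟩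
    K * suc (a / K)           ≤⟨ *-monoʳ-≤ K (1+n≤2^n (a / K)) ⟩
    K * 2 ^ (a / K)           ∎

remove-prime : ∀ {p} → Prime p → ∀ n → 0 < n →
  ∃₂ λ a m → n ≡ p ^ a * m × 0 < m × ¬ p ∣ m
remove-prime {p} pp n 0<n = go n (<-wellFounded n) 0<n
  where
  go : ∀ n → Acc _<_ n → 0 < n → ∃₂ λ a m → n ≡ p ^ a * m × 0 < m × ¬ p ∣ m
  go n (acc rs) 0<n with p ∣? n
  ... | no  p∤n = 0 , n , sym (*-identityˡ n) , 0<n , p∤n
  ... | yes (divides q n≡qp) with go q (rs (subst (q <_) (sym n≡pq) (m<p*m pp 0<q))) 0<q
    where
    n≡pq : n ≡ p * q
    n≡pq = trans n≡qp (*-comm q p)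
    0<q : 0 < q
    0<q = cofactor>0 p 0<n n≡pq
  ...   | a , m , q≡ , 0<m , p∤m = suc a , m
    , trans n≡qp (trans (*-comm q p) (trans (cong (p *_) q≡) (sym (*-assoc p (p ^ a) m)))) , 0<m , p∤m

-- d(n) ≪ n^(1/K), removing the primes below 2^K one at a time.
divisor-bound : ∀ K → .{{NonZero K}} → ∃ λ C → 0 < C × (∀ n → 0 < n → d n ^ K ≤ C * n)
divisor-bound K = let C , 0<C , bound = descend (2 ^ K) in
  C , 0<C , λ n 0<n → bound 0 (≤-reflexive refl) n 0<n (λ _ _ _ → z≤n)
  where
  open ≤-Reasoning
  -- i bounds the distance from t up to 2^K. At distance 0 `d^q≤n` applies; each step down
  -- multiplies the constant by K^K, the price of a possible prime t.
  descend : ∀ i → ∃ λ C → 0 < C × (∀ t → 2 ^ K ≤ t + i → ∀ n → 0 < n → PrimesFrom t n → d n ^ K ≤ C * n)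
  descend zero = 1 , z<s , λ t 2^K≤t n 0<n from → ≤-trans
    (d^q≤n K n 0<n λ p pp p∣n → ≤-trans (≤-trans 2^K≤t (≤-reflexive (+-identityʳ t))) (from p pp p∣n))
    (≤-reflexive (sym (*-identityˡ n)))
  descend (suc i) with descend i
  ... | C , 0<C , bound = K ^ K * C , *-mono-< (m^n>0 K K) 0<C , step
    where
    step : ∀ t → 2 ^ K ≤ t + suc i → ∀ n → 0 < n → PrimesFrom t n → d n ^ K ≤ K ^ K * C * n
    step t 2^K≤ n 0<n from with prime? t
    ... | no ¬pt = ≤-trans
      (bound (suc t) (≤-trans 2^K≤ (≤-reflexive (+-suc t i))) n 0<n
        λ p pp p∣n → ≤∧≢⇒< (from p pp p∣n) λ { refl → ¬pt pp })
      (*-monoˡ-≤ n (m≤n*m C (K ^ K) {{m^n≢0 K K}}))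
    ... | yes pt with remove-prime pt n 0<n
    ...   | a , m , refl , 0<m , t∤m = begin
      d (t ^ a * m) ^ K             ≤⟨ ^-monoˡ-≤ K (d-submultiplicative (m^n>0 t {{prime⇒nonZero pt}} a) 0<m) ⟩
      (d (t ^ a) * d m) ^ K         ≡⟨ *-^-distrib (d (t ^ a)) (d m) K ⟩
      d (t ^ a) ^ K * d m ^ K       ≤⟨ *-mono-≤ (^-monoˡ-≤ K (d[p^a]≤1+a pt a))
                                         (bound (suc t) (≤-trans 2^K≤ (≤-reflexive (+-suc t i))) m 0<m
                                           λ p pp p∣m → ≤∧≢⇒< (from p pp (∣n⇒∣m*n (t ^ a) p∣m)) λ { refl → t∤m p∣m }) ⟩
      suc a ^ K * (C * m)           ≤⟨ *-monoˡ-≤ (C * m) (polynomial≤exponential K a) ⟩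
      K ^ K * 2 ^ a * (C * m)       ≤⟨ *-monoˡ-≤ (C * m) (*-monoʳ-≤ (K ^ K) (^-monoˡ-≤ a (prime>1 pt))) ⟩
      K ^ K * t ^ a * (C * m)       ≡⟨ rearrange (K ^ K) (t ^ a) C m ⟩
      K ^ K * C * (t ^ a * m)       ∎
      where
      rearrange : ∀ x y z w → x * y * (z * w) ≡ x * z * (y * w)
      rearrange = solve-∀

^-cancelˡ-≤ : ∀ q → .{{NonZero q}} → ∀ {a b} → a ^ q ≤ b ^ q → a ≤ b
^-cancelˡ-≤ q a^q≤b^q = ≮⇒≥ λ b<a → <⇒≱ (^-monoˡ-< q b<a) a^q≤b^q

n≤n^q : ∀ n q → .{{NonZero q}} → 0 < n → n ≤ n ^ q
n≤n^q n (suc q) 0<n = m≤m*n n (n ^ q) {{m^n≢0 n q {{>-nonZero 0<n}}}}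

-- Enlarging C to C^q makes the right side a perfect q-th power, so that the root can be taken
-- within ℕ.
root-bound : ∀ q → .{{NonZero q}} → ∀ {a C n e} → 0 < C → a ^ q ≤ C * n → n ≤ 2 ^ (e * q) → a ≤ C * 2 ^ e
root-bound q {a} {C} {n} {e} 0<C a^q≤ n≤ = ^-cancelˡ-≤ q (begin
  a ^ q               ≤⟨ a^q≤ ⟩
  C * n               ≤⟨ *-mono-≤ (n≤n^q C q 0<C) n≤ ⟩
  C ^ q * 2 ^ (e * q) ≡⟨ cong (C ^ q *_) (^-*-assoc 2 e q) ⟨
  C ^ q * (2 ^ e) ^ q ≡⟨ *-^-distrib C (2 ^ e) q ⟨
  (C * 2 ^ e) ^ q     ∎)
  where open ≤-Reasoning

-- Smooth numbers

lg : ℕ → ℕ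
lg = ⌊log₂_⌋

n<2^[1+lg] : ∀ n → n < 2 ^ suc (lg n)
n<2^[1+lg] n = ≰⇒> λ 2^≤n → <⇒≱ (n<1+n (lg n))
  (subst (_≤ lg n) (⌊log₂[2^n]⌋≡n (suc (lg n))) (⌊log₂⌋-mono-≤ 2^≤n))

2^k≤n⇒k≤lg : ∀ {k n} → 2 ^ k ≤ n → k ≤ lg n
2^k≤n⇒k≤lg {k} {n} 2^k≤n = subst (_≤ lg n) (⌊log₂[2^n]⌋≡n k) (⌊log₂⌋-mono-≤ 2^k≤n)

2^lg≤n : ∀ n → 0 < n → 2 ^ lg n ≤ n
2^lg≤n n 0<n = go n (<-wellFounded n) 0<n
  where
  open ≤-Reasoning
  go : ∀ n → Acc _<_ n → 0 < n → 2 ^ lg n ≤ n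
  go 1 _ _ = ≤-refl
  go n@(2+ m) (acc rs) _ = begin
    2 ^ lg n                    ≡⟨ cong (2 ^_) lg≡ ⟩
    2 ^ suc (lg ⌊ n /2⌋)        ≡⟨ 2^-double (lg ⌊ n /2⌋) ⟩
    2 ^ lg ⌊ n /2⌋ + 2 ^ lg ⌊ n /2⌋ ≤⟨ +-mono-≤ half half ⟩
    ⌊ n /2⌋ + ⌊ n /2⌋           ≤⟨ +-monoʳ-≤ ⌊ n /2⌋ (⌊n/2⌋≤⌈n/2⌉ n) ⟩
    ⌊ n /2⌋ + ⌈ n /2⌉           ≡⟨ ⌊n/2⌋+⌈n/2⌉≡n n ⟩
    n                           ∎
    where
    half : 2 ^ lg ⌊ n /2⌋ ≤ ⌊ n /2⌋
    half = go ⌊ n /2⌋ (rs (⌊n/2⌋<n (suc m))) z<s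
    1≤lg : 1 ≤ lg n
    1≤lg = 2^k≤n⇒k≤lg {1} {n} (s≤s (s≤s z≤n))
    lg≡ : lg n ≡ suc (lg ⌊ n /2⌋)
    lg≡ = sym (trans (cong suc (⌊log₂⌊n/2⌋⌋≡⌊log₂n⌋∸1 n)) (m+[n∸m]≡n 1≤lg))

n<2^k⇒lg<k : ∀ {n k} → 0 < n → n < 2 ^ k → lg n < k
n<2^k⇒lg<k {n} {k} 0<n n<2^k = ≰⇒> λ k≤lg →
  <⇒≱ n<2^k (≤-trans (^-monoʳ-≤ 2 k≤lg) (2^lg≤n n 0<n))

2^-cancel-< : ∀ {a b} → 2 ^ a < 2 ^ b → a < b
2^-cancel-< 2^a<2^b = ≰⇒> λ b≤a → <⇒≱ 2^a<2^b (^-monoʳ-≤ 2 b≤a)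

2^-cancel-≤ : ∀ {a b} → 2 ^ a ≤ 2 ^ b → a ≤ b
2^-cancel-≤ 2^a≤2^b = ≮⇒≥ λ b<a → <⇒≱ (^-monoʳ-< 2 (s≤s (s≤s z≤n)) b<a) 2^a≤2^b

-- The logarithm of the radical

primeFactor? : ∀ n p → Dec (Prime p × p ∣ n)
primeFactor? n p = prime? p ×-dec p ∣? n

-- A discrete logarithm of the radical: a prime factor below R counts once, whatever its
-- multiplicity.
logRad : ℕ → ℕ → ℕ
logRad R n = ∑ R (λ p → ⟦ primeFactor? n p ⟧ * lg p)

logRad-1 : ∀ R → logRad R 1 ≤ 0
logRad-1 R = ≤-trans
  (∑-bounded R 0 λ p _ → ⟦⟧*-≤ (primeFactor? 1 p) λ (pp , p∣1) →
    contradiction (∣⇒≤ p∣1) (<⇒≱ (prime>1 pp)))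
  (≤-reflexive (*-zeroʳ R))

logRad-mono-∣ : ∀ R {m n} → m ∣ n → logRad R m ≤ logRad R n
logRad-mono-∣ R {m} {n} m∣n = ∑-mono R λ p _ → *-monoˡ-≤ (lg p)
  (⟦⟧-mono (primeFactor? m p) (primeFactor? n p) λ (pp , p∣m) → pp , ∣-trans p∣m m∣n)

prime∣prime⇒≡ : ∀ {p q} → Prime p → Prime q → q ∣ p → q ≡ p
prime∣prime⇒≡ pp pq q∣p with prime⇒irreducible pp q∣p
... | inj₁ refl = contradiction pq ¬prime[1]
... | inj₂ q≡p  = q≡p

logRad-*-≤ : ∀ R {p} n → Prime p → logRad R (p * n) ≤ lg p + logRad R n
logRad-*-≤ R {p} n pp = begin
  logRad R (p * n)
    ≤⟨ ∑-mono R (λ q _ → begin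
         ⟦ primeFactor? (p * n) q ⟧ * lg q
           ≤⟨ *-monoˡ-≤ (lg q) (⟦⟧-≤ (primeFactor? (p * n) q) (cases q)) ⟩
         (⟦ q ≟ p ⟧ + ⟦ primeFactor? n q ⟧) * lg q
           ≡⟨ *-distribʳ-+ (lg q) ⟦ q ≟ p ⟧ _ ⟩
         ⟦ q ≟ p ⟧ * lg q + ⟦ primeFactor? n q ⟧ * lg q ∎) ⟩
  ∑ R (λ q → ⟦ q ≟ p ⟧ * lg q + ⟦ primeFactor? n q ⟧ * lg q)
    ≡⟨ ∑-+ R (λ q → ⟦ q ≟ p ⟧ * lg q) _ ⟩
  ∑ R (λ q → ⟦ q ≟ p ⟧ * lg q) + logRad R n
    ≤⟨ +-monoˡ-≤ (logRad R n) (∑-⟦≡⟧*≤ R p lg) ⟩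
  lg p + logRad R n ∎
  where
  open ≤-Reasoning
  cases : ∀ q → Prime q × q ∣ p * n → 1 ≤ ⟦ q ≟ p ⟧ + ⟦ primeFactor? n q ⟧
  cases q (pq , q∣pn) with euclidsLemma p n pq q∣pn
  ... | inj₁ q∣p = ≤-trans (≤-reflexive (sym (⟦⟧-yes (q ≟ p) (prime∣prime⇒≡ pp pq q∣p)))) (m≤m+n _ _)
  ... | inj₂ q∣n = ≤-trans (≤-reflexive (sym (⟦⟧-yes (primeFactor? n q) (pq , q∣n)))) (m≤n+m _ _)

∑-⟦≡⟧*≥ : ∀ {n a} (f : ℕ → ℕ) → a < n → f a ≤ ∑ n (λ i → ⟦ i ≟ a ⟧ * f i)
∑-⟦≡⟧*≥ {n} {a} f a<n = ≤-trans
  (≤-reflexive (trans (sym (*-identityˡ (f a))) (cong (_* f a) (sym (⟦⟧-yes (a ≟ a) refl)))))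
  (∑-point n (λ i → ⟦ i ≟ a ⟧ * f i) a<n)

logRad-*-≥ : ∀ R {p} n → Prime p → p < R → ¬ p ∣ n → lg p + logRad R n ≤ logRad R (p * n)
logRad-*-≥ R {p} n pp p<R p∤n = begin
  lg p + logRad R n
    ≤⟨ +-monoˡ-≤ (logRad R n) (∑-⟦≡⟧*≥ lg p<R) ⟩
  ∑ R (λ q → ⟦ q ≟ p ⟧ * lg q) + logRad R n
    ≡⟨ ∑-+ R (λ q → ⟦ q ≟ p ⟧ * lg q) _ ⟨
  ∑ R (λ q → ⟦ q ≟ p ⟧ * lg q + ⟦ primeFactor? n q ⟧ * lg q)
    ≤⟨ ∑-mono R (λ q _ → begin
         ⟦ q ≟ p ⟧ * lg q + ⟦ primeFactor? n q ⟧ * lg q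
           ≡⟨ *-distribʳ-+ (lg q) ⟦ q ≟ p ⟧ _ ⟨
         (⟦ q ≟ p ⟧ + ⟦ primeFactor? n q ⟧) * lg q
           ≤⟨ *-monoˡ-≤ (lg q) (exclusive q) ⟩
         ⟦ primeFactor? (p * n) q ⟧ * lg q ∎) ⟩
  logRad R (p * n) ∎
  where
  open ≤-Reasoning
  exclusive : ∀ q → ⟦ q ≟ p ⟧ + ⟦ primeFactor? n q ⟧ ≤ ⟦ primeFactor? (p * n) q ⟧
  exclusive q with q ≟ p
  ... | yes refl = ≤-reflexive (trans
    (cong suc (⟦⟧-no (primeFactor? n p) λ (_ , p∣n) → p∤n p∣n))
    (sym (⟦⟧-yes (primeFactor? (p * n) p) (pp , m∣m*n n))))
  ... | no _ = ⟦⟧-mono (primeFactor? n q) (primeFactor? (p * n) q)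
    λ (pq , q∣n) → pq , ∣n⇒∣m*n p q∣n

-- Each factor p adds at most lg p to `logRad`, and 2^(lg p) ≤ p.
2^logRad≤n : ∀ R n → 0 < n → 2 ^ logRad R n ≤ n
2^logRad≤n R = prime-induction (λ n → 2 ^ logRad R n ≤ n) (^-monoʳ-≤ 2 (logRad-1 R))
  λ p n pp 0<n ih → begin
    2 ^ logRad R (p * n)      ≤⟨ ^-monoʳ-≤ 2 (logRad-*-≤ R n pp) ⟩
    2 ^ (lg p + logRad R n)   ≡⟨ ^-distribˡ-+-* 2 (lg p) (logRad R n) ⟩
    2 ^ lg p * 2 ^ logRad R n ≤⟨ *-mono-≤ (2^lg≤n p (<-trans z<s (prime>1 pp))) (ih n 0<n (m<p*m pp 0<n)) ⟩
    p * n                ∎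
  where open ≤-Reasoning

PrimesBelow : ℕ → ℕ → Set
PrimesBelow R n = ∀ p → Prime p → p ∣ n → p < R

-- Rounding loses a factor below 2, which 2^(lg p) absorbs because lg p ≥ 1.
prime≤4^lg : ∀ {p} → Prime p → p ≤ 4 ^ lg p
prime≤4^lg {p} pp = begin
  p                ≤⟨ <⇒≤ (n<2^[1+lg] p) ⟩
  2 ^ suc (lg p)   ≤⟨ ^-monoʳ-≤ 2 (+-monoˡ-≤ (lg p) (2^k≤n⇒k≤lg {1} (prime>1 pp))) ⟩
  2 ^ (lg p + lg p) ≡⟨ cong (λ x → 2 ^ (lg p + x)) (+-identityʳ (lg p)) ⟨
  2 ^ (2 * lg p)   ≡⟨ ^-*-assoc 2 2 (lg p) ⟨
  4 ^ lg p         ∎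
  where open ≤-Reasoning

-- A prime that occurs once is paid for by p ≤ 4^(lg p); a repeated one is moved in pairs into b².
-- Hence a large n with small `logRad` has a large square divisor.
large-square-divisor : ∀ R n → 0 < n → PrimesBelow R n →
  ∃ λ b → b * b ∣ n × n ≤ b * b * 4 ^ logRad R n
large-square-divisor R = prime-induction
  (λ n → PrimesBelow R n → ∃ λ b → b * b ∣ n × n ≤ b * b * 4 ^ logRad R n)
  (λ _ → 1 , ∣-refl , ≤-trans (m^n>0 4 (logRad R 1)) (≤-reflexive (sym (*-identityˡ _)))) step
  where
  open ≤-Reasoning
  step : ∀ p n → Prime p → 0 < n →
    (∀ m → 0 < m → m < p * n → PrimesBelow R m → ∃ λ b → b * b ∣ m × m ≤ b * b * 4 ^ logRad R m) →
    PrimesBelow R (p * n) → ∃ λ b → b * b ∣ p * n × p * n ≤ b * b * 4 ^ logRad R (p * n)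
  step p n pp 0<n ih below with p ∣? n
  ... | no p∤n =
    let b , b²∣n , n≤ = ih n 0<n (m<p*m pp 0<n) (λ q pq q∣n → below q pq (∣n⇒∣m*n p q∣n)) in
    b , ∣n⇒∣m*n p b²∣n , (begin
      p * n                             ≤⟨ *-mono-≤ (prime≤4^lg pp) n≤ ⟩
      4 ^ lg p * (b * b * 4 ^ logRad R n)    ≡⟨ swap (4 ^ lg p) (b * b) (4 ^ logRad R n) ⟩
      b * b * (4 ^ lg p * 4 ^ logRad R n)    ≡⟨ cong (b * b *_) (^-distribˡ-+-* 4 (lg p) (logRad R n)) ⟨
      b * b * 4 ^ (lg p + logRad R n)        ≤⟨ *-monoʳ-≤ (b * b) (^-monoʳ-≤ 4
                                             (logRad-*-≥ R n pp (below p pp (m∣m*n n)) p∤n)) ⟩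
      b * b * 4 ^ logRad R (p * n)           ∎)
    where
    swap : ∀ x y z → x * (y * z) ≡ y * (x * z)
    swap = solve-∀
  ... | yes (divides m n≡mp) =
    let b , b²∣m , m≤ = ih m 0<m m<pn (λ q pq q∣m → below q pq (∣-trans q∣m m∣pn)) in
    p * b , subst (_∣ p * n) (sym (sq p b)) (subst (p * p * (b * b) ∣_) (sym pn≡) (*-monoʳ-∣ (p * p) b²∣m)) , (begin
      p * n                               ≡⟨ pn≡ ⟩
      p * p * m                           ≤⟨ *-monoʳ-≤ (p * p) m≤ ⟩
      p * p * (b * b * 4 ^ logRad R m)         ≡⟨ *-assoc (p * p) (b * b) _ ⟨
      p * p * (b * b) * 4 ^ logRad R m         ≡⟨ cong (_* 4 ^ logRad R m) (sq p b) ⟨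
      p * b * (p * b) * 4 ^ logRad R m         ≤⟨ *-monoʳ-≤ (p * b * (p * b)) (^-monoʳ-≤ 4 (logRad-mono-∣ R m∣pn)) ⟩
      p * b * (p * b) * 4 ^ logRad R (p * n)   ∎)
    where
    sq : ∀ p b → p * b * (p * b) ≡ p * p * (b * b)
    sq = solve-∀
    pn≡ : p * n ≡ p * p * m
    pn≡ = trans (cong (p *_) (trans n≡mp (*-comm m p))) (sym (*-assoc p p m))
    m∣pn : m ∣ p * n
    m∣pn = divides (p * p) pn≡
    0<m : 0 < m
    0<m = cofactor>0 p 0<n (trans n≡mp (*-comm m p))
    m<pn : m < p * n
    m<pn = ≤-<-trans (≤-trans (m≤n*m m p {{prime⇒nonZero pp}}) (≤-reflexive (trans (*-comm p m) (sym n≡mp)))) (m<p*m pp 0<n)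

-- Multiples and a Mertens estimate

multiple? : ∀ c n → Dec (0 < n × c ∣ n)
multiple? c n = 0 <? n ×-dec c ∣? n

-- Excluding n = 0, a multiple of every c, is what makes the count at most N / c.
multiples : ℕ → ℕ → ℕ
multiples N c = ∑ N (λ n → ⟦ multiple? c n ⟧)

multiples-upper : ∀ N c → multiples N c * c ≤ N
multiples-upper N zero      = ≤-trans (≤-reflexive (*-zeroʳ (multiples N 0))) z≤n
multiples-upper N c@(suc _) = begin
  multiples N c * c                       ≤⟨ *-monoˡ-≤ c (count-surj (multiple? c) (λ m → m <? N / c) (λ m → suc m * c) N (N / c) preimage) ⟩
  ∑ (N / c) (λ m → ⟦ m <? N / c ⟧) * c    ≤⟨ *-monoˡ-≤ c (∑-bounded (N / c) 1 λ m _ → ⟦⟧≤1 (m <? N / c)) ⟩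
  N / c * 1 * c                           ≡⟨ cong (_* c) (*-identityʳ (N / c)) ⟩
  N / c * c                               ≤⟨ m/n*n≤m N c ⟩
  N                                       ∎
  where
  open ≤-Reasoning
  preimage : ∀ n → n < N → 0 < n × c ∣ n → ∃ λ m → m < N / c × m < N / c × n ≡ suc m * c
  preimage n n<N (0<n , divides zero    refl) = contradiction 0<n (<-irrefl refl)
  preimage n n<N (0<n , divides (suc q) refl) = q , q< , q< , refl
    where
    q< : q < N / c
    q< = subst (_≤ N / c) (m*n/n≡m (suc q) c) (/-monoˡ-≤ c (<⇒≤ n<N))

multiples-lower : ∀ N c r → .{{NonZero c}} → r * c < N → r ≤ multiples N c
multiples-lower N c r rc<N = begin
  r                                ≡⟨ *-identityʳ r ⟨
  r * 1                            ≡⟨ ∑-const r 1 ⟨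
  ∑ r (λ _ → 1)                    ≤⟨ ∑-mono r (λ m m<r → ≤-reflexive (sym (⟦⟧-yes (m <? r) m<r))) ⟩
  ∑ r (λ m → ⟦ m <? r ⟧)           ≤⟨ count-surj (_<? r) (multiple? c) (λ n → pred (n / c)) r N
                                        (λ m _ m<r → suc m * c , ≤-<-trans (*-monoˡ-≤ c m<r) rc<N
                                          , (≤-trans (>-nonZero⁻¹ c) (m≤m+n c (m * c)) , n∣m*n (suc m))
                                          , sym (cong pred (m*n/n≡m (suc m) c))) ⟩
  multiples N c                    ∎
  where open ≤-Reasoning

-- ∑_{p < 2^j} log p / p = O(j), by counting the pairs p ∣ n with 0 < n < 2^j.
mertens : ∀ j → ∑ (2 ^ j) (λ p → ⟦ prime? p ⟧ * (lg p * 2 ^ (j ∸ lg p))) ≤ 2 * (2 ^ j * j)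
mertens j = begin
  ∑ (2 ^ j) (λ p → ⟦ prime? p ⟧ * (lg p * 2 ^ (j ∸ lg p)))
    ≤⟨ ∑-mono (2 ^ j) pointwise ⟩
  ∑ (2 ^ j) (λ p → 2 * ∑ (2 ^ j) (F p))
    ≡⟨ ∑-*ˡ (2 ^ j) 2 _ ⟩
  2 * ∑ (2 ^ j) (λ p → ∑ (2 ^ j) (F p))
    ≡⟨ cong (2 *_) (∑-swap (2 ^ j) (2 ^ j) F) ⟩
  2 * ∑ (2 ^ j) (λ n → ∑ (2 ^ j) (λ p → F p n))
    ≤⟨ *-monoʳ-≤ 2 (∑-bounded (2 ^ j) j column) ⟩
  2 * (2 ^ j * j) ∎
  where
  open ≤-Reasoning
  F : ℕ → ℕ → ℕ
  F p n = ⟦ 0 <? n ⟧ * (⟦ primeFactor? n p ⟧ * lg p)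
  -- For fixed n > 0 the sum over p is `logRad (2 ^ j) n`, and 2^logRad ≤ n < 2^j.
  column : ∀ n → n < 2 ^ j → ∑ (2 ^ j) (λ p → F p n) ≤ j
  column n n<2^j = ≤-trans (≤-reflexive (∑-*ˡ (2 ^ j) ⟦ 0 <? n ⟧ _))
    (⟦⟧*-≤ (0 <? n) λ 0<n → <⇒≤ (2^-cancel-< (≤-<-trans (2^logRad≤n (2 ^ j) n 0<n) n<2^j)))
  factor : ∀ p n → ⟦ prime? p ⟧ * lg p * ⟦ multiple? p n ⟧ ≡ F p n
  factor p n = trans (cong (⟦ prime? p ⟧ * lg p *_) (⟦⟧-× (0 <? n) (p ∣? n)))
    (trans (rearrange ⟦ prime? p ⟧ (lg p) ⟦ 0 <? n ⟧ ⟦ p ∣? n ⟧)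
           (cong (λ x → ⟦ 0 <? n ⟧ * (x * lg p)) (sym (⟦⟧-× (prime? p) (p ∣? n)))))
    where
    rearrange : ∀ a b c e → a * b * (c * e) ≡ c * (a * e * b)
    rearrange = solve-∀
  -- As p < 2^(lg p + 1), there are at least 2^(j - lg p - 1) positive multiples of p below 2^j;
  -- this rounding is the source of the factor 2.
  power : ∀ p → p < 2 ^ j → Prime p → 2 ^ (j ∸ lg p) ≤ 2 * multiples (2 ^ j) p
  power p p<2^j pp = begin
    2 ^ (j ∸ lg p)             ≡⟨ cong (2 ^_) (+-∸-assoc 1 lg<j) ⟩
    2 * 2 ^ (j ∸ suc (lg p))   ≤⟨ *-monoʳ-≤ 2 (multiples-lower (2 ^ j) p (2 ^ (j ∸ suc (lg p))) {{prime⇒nonZero pp}} (begin-strict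
      2 ^ (j ∸ suc (lg p)) * p                 <⟨ *-monoʳ-< (2 ^ (j ∸ suc (lg p))) {{2^-nonZero (j ∸ suc (lg p))}} (n<2^[1+lg] p) ⟩
      2 ^ (j ∸ suc (lg p)) * 2 ^ suc (lg p)    ≡⟨ ^-distribˡ-+-* 2 (j ∸ suc (lg p)) (suc (lg p)) ⟨
      2 ^ (j ∸ suc (lg p) + suc (lg p))        ≡⟨ cong (2 ^_) (m∸n+n≡m lg<j) ⟩
      2 ^ j                                    ∎)) ⟩
    2 * multiples (2 ^ j) p    ∎
    where
    lg<j : lg p < j
    lg<j = n<2^k⇒lg<k (<-trans z<s (prime>1 pp)) p<2^j
  pointwise : ∀ p → p < 2 ^ j → ⟦ prime? p ⟧ * (lg p * 2 ^ (j ∸ lg p)) ≤ 2 * ∑ (2 ^ j) (F p)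
  pointwise p p<2^j = begin
    ⟦ prime? p ⟧ * (lg p * 2 ^ (j ∸ lg p))
      ≤⟨ ⟦⟧*-≤ (prime? p) (λ pp → begin
           lg p * 2 ^ (j ∸ lg p)                          ≤⟨ *-monoʳ-≤ (lg p) (power p p<2^j pp) ⟩
           lg p * (2 * multiples (2 ^ j) p)               ≡⟨ *-identityˡ _ ⟨
           1 * (lg p * (2 * multiples (2 ^ j) p))         ≡⟨ cong (_* (lg p * (2 * multiples (2 ^ j) p))) (⟦⟧-yes (prime? p) pp) ⟨
           ⟦ prime? p ⟧ * (lg p * (2 * multiples (2 ^ j) p)) ∎) ⟩
    ⟦ prime? p ⟧ * (lg p * (2 * multiples (2 ^ j) p))
      ≡⟨ rearrange ⟦ prime? p ⟧ (lg p) (multiples (2 ^ j) p) ⟩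
    2 * (⟦ prime? p ⟧ * lg p * multiples (2 ^ j) p)
      ≡⟨ cong (2 *_) (∑-*ˡ (2 ^ j) (⟦ prime? p ⟧ * lg p) _) ⟨
    2 * ∑ (2 ^ j) (λ n → ⟦ prime? p ⟧ * lg p * ⟦ multiple? p n ⟧)
      ≡⟨ cong (2 *_) (∑-cong (2 ^ j) (factor p)) ⟩
    2 * ∑ (2 ^ j) (F p) ∎
    where
    rearrange : ∀ a b c → a * (b * (2 * c)) ≡ 2 * (a * b * c)
    rearrange = solve-∀

-- Counting smooth numbers

Smooth : ℕ → ℕ → Set
Smooth j n = 0 < n × (∀ {p} → p < suc n → Prime p → p ∣ n → p < 2 ^ j)

-- The bound `p < suc n` in `Smooth` is there for this decision by a finite search; for n > 0 every
-- divisor satisfies it.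
smooth? : ∀ j n → Dec (Smooth j n)
smooth? j n = 0 <? n ×-dec allUpTo? (λ p → prime? p →-dec (p ∣? n →-dec p <? 2 ^ j)) (suc n)

smooth⇒below : ∀ j {n} → Smooth j n → PrimesBelow (2 ^ j) n
smooth⇒below j (0<n , below) p pp p∣n = below (s≤s (∣⇒≤ {{>-nonZero 0<n}} p∣n)) pp p∣n

below⇒smooth : ∀ j {n} → 0 < n → PrimesBelow (2 ^ j) n → Smooth j n
below⇒smooth j 0<n below = 0<n , λ {p} _ → below p

smooth-∣ : ∀ j {m n} → m ∣ n → Smooth j n → Smooth j m
smooth-∣ j m∣n s@(0<n , _) =
  below⇒smooth j (∣⇒>0 0<n m∣n) λ p pp p∣m → smooth⇒below j s p pp (∣-trans p∣m m∣n)

-- The usual Ψ(x, y) with x = 2^i and y = 2^j, both inequalities strict.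
Ψ : ℕ → ℕ → ℕ
Ψ j i = ∑ (2 ^ i) (λ n → ⟦ smooth? j n ⟧)

Ψ≤2^ : ∀ j i → Ψ j i ≤ 2 ^ i
Ψ≤2^ j i = ≤-trans (∑-bounded (2 ^ i) 1 λ n _ → ⟦⟧≤1 (smooth? j n)) (≤-reflexive (*-identityʳ _))

-- After exchanging the sums, a smooth multiple n = p m of p below 2^i comes from a smooth m < 2^i /
-- p ≤ 2^(i - lg p).
∑-smooth-logRad : ∀ j i → j ≤ i →
  ∑ (2 ^ i) (λ n → ⟦ smooth? j n ⟧ * logRad (2 ^ j) n)
    ≤ ∑ (2 ^ j) (λ p → ⟦ prime? p ⟧ * (lg p * Ψ j (i ∸ lg p)))
∑-smooth-logRad j i j≤i = begin
  ∑ (2 ^ i) (λ n → ⟦ smooth? j n ⟧ * logRad (2 ^ j) n)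
    ≡⟨ ∑-cong (2 ^ i) (λ n → sym (∑-*ˡ (2 ^ j) ⟦ smooth? j n ⟧ _)) ⟩
  ∑ (2 ^ i) (λ n → ∑ (2 ^ j) λ p → ⟦ smooth? j n ⟧ * (⟦ primeFactor? n p ⟧ * lg p))
    ≡⟨ ∑-swap (2 ^ i) (2 ^ j) _ ⟩
  ∑ (2 ^ j) (λ p → ∑ (2 ^ i) λ n → ⟦ smooth? j n ⟧ * (⟦ primeFactor? n p ⟧ * lg p))
    ≡⟨ ∑-cong (2 ^ j) (λ p → ∑-cong (2 ^ i) (factor p)) ⟩
  ∑ (2 ^ j) (λ p → ∑ (2 ^ i) λ n → ⟦ prime? p ⟧ * lg p * ⟦ smooth? j n ×-dec p ∣? n ⟧)
    ≡⟨ ∑-cong (2 ^ j) (λ p → ∑-*ˡ (2 ^ i) (⟦ prime? p ⟧ * lg p) _) ⟩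
  ∑ (2 ^ j) (λ p → ⟦ prime? p ⟧ * lg p * ∑ (2 ^ i) λ n → ⟦ smooth? j n ×-dec p ∣? n ⟧)
    ≤⟨ ∑-mono (2 ^ j) (λ p p< → begin
         ⟦ prime? p ⟧ * lg p * C p    ≡⟨ *-assoc ⟦ prime? p ⟧ (lg p) (C p) ⟩
         ⟦ prime? p ⟧ * (lg p * C p)  ≤⟨ weaken p p< (prime? p) ⟩
         ⟦ prime? p ⟧ * (lg p * Ψ j (i ∸ lg p)) ∎) ⟩
  ∑ (2 ^ j) (λ p → ⟦ prime? p ⟧ * (lg p * Ψ j (i ∸ lg p))) ∎
  where
  open ≤-Reasoning
  C : ℕ → ℕ
  C p = ∑ (2 ^ i) λ n → ⟦ smooth? j n ×-dec p ∣? n ⟧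
  factor : ∀ p n → ⟦ smooth? j n ⟧ * (⟦ primeFactor? n p ⟧ * lg p)
                 ≡ ⟦ prime? p ⟧ * lg p * ⟦ smooth? j n ×-dec p ∣? n ⟧
  factor p n = trans (cong (λ x → ⟦ smooth? j n ⟧ * (x * lg p)) (⟦⟧-× (prime? p) (p ∣? n)))
    (trans (rearrange ⟦ smooth? j n ⟧ ⟦ prime? p ⟧ ⟦ p ∣? n ⟧ (lg p))
           (cong (⟦ prime? p ⟧ * lg p *_) (sym (⟦⟧-× (smooth? j n) (p ∣? n)))))
    where
    rearrange : ∀ a b c e → a * (b * c * e) ≡ b * e * (a * c)
    rearrange = solve-∀
  count : ∀ p → p < 2 ^ j → Prime p → C p ≤ Ψ j (i ∸ lg p)
  count p p<2^j pp = count-surj (λ n → smooth? j n ×-dec p ∣? n) (smooth? j) (p *_) (2 ^ i) (2 ^ (i ∸ lg p)) preimage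
    where
    lg≤i : lg p ≤ i
    lg≤i = ≤-trans (<⇒≤ (n<2^k⇒lg<k (<-trans z<s (prime>1 pp)) p<2^j)) j≤i
    preimage : ∀ n → n < 2 ^ i → Smooth j n × p ∣ n → ∃ λ m → m < 2 ^ (i ∸ lg p) × Smooth j m × n ≡ p * m
    preimage n n<2^i (sm , divides q n≡qp) =
      q , *-cancelˡ-< p q _ (begin-strict
        p * q                      ≡⟨ n≡pq ⟨
        n                          <⟨ n<2^i ⟩
        2 ^ i                      ≡⟨ cong (2 ^_) (m+[n∸m]≡n lg≤i) ⟨
        2 ^ (lg p + (i ∸ lg p))    ≡⟨ ^-distribˡ-+-* 2 (lg p) (i ∸ lg p) ⟩
        2 ^ lg p * 2 ^ (i ∸ lg p)  ≤⟨ *-monoˡ-≤ (2 ^ (i ∸ lg p)) (2^lg≤n p (<-trans z<s (prime>1 pp))) ⟩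
        p * 2 ^ (i ∸ lg p)         ∎)
      , smooth-∣ j (divides p n≡pq) sm , n≡pq
      where
      n≡pq : n ≡ p * q
      n≡pq = trans n≡qp (*-comm q p)
  weaken : ∀ p → p < 2 ^ j → (p? : Dec (Prime p)) →
           ⟦ p? ⟧ * (lg p * C p) ≤ ⟦ p? ⟧ * (lg p * Ψ j (i ∸ lg p))
  weaken p p< (yes pp) = *-monoʳ-≤ 1 (*-monoʳ-≤ (lg p) (count p p< pp))
  weaken p p< (no _)   = z≤n

-- Inserts a density bound A / Bv at the scales i - lg p. Writing 2^(i - lg p) as 2^(i - j) · 2^(j -
-- lg p) brings the sum over p into the form of `mertens`.
∑-prime-bound : ∀ j i A Bv → j ≤ i →
  (∀ a → a ≤ j → Ψ j (i ∸ a) * Bv ≤ A * 2 ^ (i ∸ a)) →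
  ∑ (2 ^ j) (λ p → ⟦ prime? p ⟧ * (lg p * Ψ j (i ∸ lg p))) * Bv ≤ A * (2 * (2 ^ i * j))
∑-prime-bound j i A Bv j≤i hyp = begin
  ∑ (2 ^ j) (λ p → ⟦ prime? p ⟧ * (lg p * Ψ j (i ∸ lg p))) * Bv
    ≡⟨ ∑-*ʳ (2 ^ j) Bv _ ⟨
  ∑ (2 ^ j) (λ p → ⟦ prime? p ⟧ * (lg p * Ψ j (i ∸ lg p)) * Bv)
    ≤⟨ ∑-mono (2 ^ j) (λ p p< → pointwise p p< (prime? p)) ⟩
  ∑ (2 ^ j) (λ p → A * 2 ^ (i ∸ j) * (⟦ prime? p ⟧ * (lg p * 2 ^ (j ∸ lg p))))
    ≡⟨ ∑-*ˡ (2 ^ j) (A * 2 ^ (i ∸ j)) _ ⟩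
  A * 2 ^ (i ∸ j) * ∑ (2 ^ j) (λ p → ⟦ prime? p ⟧ * (lg p * 2 ^ (j ∸ lg p)))
    ≤⟨ *-monoʳ-≤ (A * 2 ^ (i ∸ j)) (mertens j) ⟩
  A * 2 ^ (i ∸ j) * (2 * (2 ^ j * j))
    ≡⟨ rearrange A (2 ^ (i ∸ j)) (2 ^ j) j ⟩
  A * (2 * (2 ^ (i ∸ j) * 2 ^ j * j))
    ≡⟨ cong (λ x → A * (2 * (x * j))) (trans (sym (^-distribˡ-+-* 2 (i ∸ j) j)) (cong (2 ^_) (m∸n+n≡m j≤i))) ⟩
  A * (2 * (2 ^ i * j)) ∎
  where
  open ≤-Reasoning
  rearrange : ∀ a x y j → a * x * (2 * (y * j)) ≡ a * (2 * (x * y * j))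
  rearrange = solve-∀
  pointwise : ∀ p → p < 2 ^ j → (p? : Dec (Prime p)) →
    ⟦ p? ⟧ * (lg p * Ψ j (i ∸ lg p)) * Bv ≤ A * 2 ^ (i ∸ j) * (⟦ p? ⟧ * (lg p * 2 ^ (j ∸ lg p)))
  pointwise p p< (no _)   = z≤n
  pointwise p p< (yes pp) = begin
    1 * (lg p * Ψ j (i ∸ lg p)) * Bv                 ≡⟨ reassoc (lg p) (Ψ j (i ∸ lg p)) Bv ⟩
    lg p * (Ψ j (i ∸ lg p) * Bv)                     ≤⟨ *-monoʳ-≤ (lg p) (hyp (lg p) lg≤j) ⟩
    lg p * (A * 2 ^ (i ∸ lg p))                      ≡⟨ cong (λ x → lg p * (A * x)) split ⟩
    lg p * (A * (2 ^ (i ∸ j) * 2 ^ (j ∸ lg p)))      ≡⟨ reassoc′ (lg p) A (2 ^ (i ∸ j)) (2 ^ (j ∸ lg p)) ⟩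
    A * 2 ^ (i ∸ j) * (1 * (lg p * 2 ^ (j ∸ lg p)))  ∎
    where
    reassoc : ∀ l x b → 1 * (l * x) * b ≡ l * (x * b)
    reassoc = solve-∀
    reassoc′ : ∀ l a x y → l * (a * (x * y)) ≡ a * x * (1 * (l * y))
    reassoc′ = solve-∀
    lg≤j : lg p ≤ j
    lg≤j = <⇒≤ (n<2^k⇒lg<k (<-trans z<s (prime>1 pp)) p<)
    split : 2 ^ (i ∸ lg p) ≡ 2 ^ (i ∸ j) * 2 ^ (j ∸ lg p)
    split = trans
      (cong (2 ^_) (trans (cong (_∸ lg p) (sym (m∸n+n≡m j≤i))) (+-∸-assoc (i ∸ j) lg≤j)))
      (^-distribˡ-+-* 2 (i ∸ j) (j ∸ lg p))

-- The n < 2^i to which the bound e ≤ logRad n may fail to apply: those below 2^(6e)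
-- or with a square divisor b², b ≥ 2^(2e).
exceptional : ℕ → ℕ → ℕ → ℕ
exceptional e i n =
  ⟦ n <? 2 ^ (6 * e) ⟧ + ∑ (2 ^ i) (λ b → ⟦ 2 ^ (2 * e) ≤? b ⟧ * ⟦ multiple? (b * b) n ⟧)

-- If n ≥ 2^(6e) and the b of `large-square-divisor` is below 2^(2e), then 4^logRad ≥ n / b² ≥
-- 2^(2e), so logRad ≥ e.
e≤logRad-or-exceptional : ∀ j e i n → n < 2 ^ i →
  e * ⟦ smooth? j n ⟧ ≤ ⟦ smooth? j n ⟧ * logRad (2 ^ j) n + e * exceptional e i n
e≤logRad-or-exceptional j e i n n<2^i with smooth? j n
... | no _   = ≤-trans (≤-reflexive (*-zeroʳ e)) z≤n
... | yes sm with n <? 2 ^ (6 * e)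
...   | yes n<  = ≤-trans (*-monoʳ-≤ e (s≤s z≤n)) (m≤n+m _ _)
...   | no  n≮ with large-square-divisor (2 ^ j) n (proj₁ sm) (smooth⇒below j sm)
...     | b , b²∣n , n≤ with 2 ^ (2 * e) ≤? b
...       | yes 2^≤b = begin
  e * 1                      ≡⟨ cong (e *_) (cong₂ _*_ (⟦⟧-yes (2 ^ (2 * e) ≤? b) 2^≤b)
                                  (⟦⟧-yes (multiple? (b * b) n) (proj₁ sm , b²∣n))) ⟨
  e * F b                    ≤⟨ *-monoʳ-≤ e (∑-point (2 ^ i) F b<2^i) ⟩
  e * ∑ (2 ^ i) F            ≤⟨ m≤n+m _ _ ⟩
  1 * logRad (2 ^ j) n + e * (0 + ∑ (2 ^ i) F)  ∎
  where
  open ≤-Reasoning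
  F : ℕ → ℕ
  F b = ⟦ 2 ^ (2 * e) ≤? b ⟧ * ⟦ multiple? (b * b) n ⟧
  b<2^i : b < 2 ^ i
  b<2^i = ≤-<-trans (m≤m*n b b {{>-nonZero (≤-trans (m^n>0 2 (2 * e)) 2^≤b)}})
            (≤-<-trans (∣⇒≤ {{>-nonZero (proj₁ sm)}} b²∣n) n<2^i)
...       | no 2^≰b = begin
  e * 1            ≡⟨ *-identityʳ e ⟩
  e                ≤⟨ *-cancelˡ-≤ 2 (+-cancelˡ-≤ (4 * e) _ _ (2^-cancel-≤ (begin
    2 ^ (4 * e + 2 * e)                        ≡⟨ cong (2 ^_) (*-distribʳ-+ e 4 2) ⟨
    2 ^ (6 * e)                                ≤⟨ ≮⇒≥ n≮ ⟩
    n                                          ≤⟨ n≤ ⟩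
    b * b * 4 ^ logRad (2 ^ j) n                    ≤⟨ *-mono-≤ (*-mono-≤ b≤ b≤) (≤-reflexive (^-*-assoc 2 2 (logRad (2 ^ j) n))) ⟩
    2 ^ (2 * e) * 2 ^ (2 * e) * 2 ^ (2 * logRad (2 ^ j) n)
                                               ≡⟨ cong (_* 2 ^ (2 * logRad (2 ^ j) n)) (^-distribˡ-+-* 2 (2 * e) (2 * e)) ⟨
    2 ^ (2 * e + 2 * e) * 2 ^ (2 * logRad (2 ^ j) n) ≡⟨ cong (λ x → 2 ^ x * 2 ^ (2 * logRad (2 ^ j) n)) (*-distribʳ-+ e 2 2) ⟨
    2 ^ (4 * e) * 2 ^ (2 * logRad (2 ^ j) n)        ≡⟨ ^-distribˡ-+-* 2 (4 * e) (2 * logRad (2 ^ j) n) ⟨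
    2 ^ (4 * e + 2 * logRad (2 ^ j) n)              ∎))) ⟩
  logRad (2 ^ j) n      ≡⟨ *-identityˡ _ ⟨
  1 * logRad (2 ^ j) n  ≤⟨ m≤m+n _ _ ⟩
  _                ∎
  where
  open ≤-Reasoning
  b≤ : b ≤ 2 ^ (2 * e)
  b≤ = <⇒≤ (≰⇒> 2^≰b)

∑-⟦<⟧ : ∀ N c → ∑ N (λ n → ⟦ n <? c ⟧) ≤ c
∑-⟦<⟧ N c = begin
  ∑ N (λ n → ⟦ n <? c ⟧)  ≤⟨ count-surj (_<? c) (_<? c) id N c (λ n _ n<c → n , n<c , n<c , refl) ⟩
  ∑ c (λ n → ⟦ n <? c ⟧)  ≤⟨ ∑-bounded c 1 (λ n _ → ⟦⟧≤1 (n <? c)) ⟩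
  c * 1                   ≡⟨ *-identityʳ c ⟩
  c                       ∎
  where open ≤-Reasoning

-- Times 2^(2e), the n < 2^(6e) number at most 2^i since 8e ≤ i, and those with square divisors
-- contribute at most i · 2^i. The loss 1 + i ≤ 8(e + 1) ≤ 8 · 2^e uses up one of the two factors
-- 2^e.
∑-exceptional : ∀ e i → 8 * e ≤ i → i < 8 * suc e →
  ∑ (2 ^ i) (exceptional e i) * 2 ^ e ≤ 8 * 2 ^ i
∑-exceptional e i 8e≤i i<8e+8 = *-cancelʳ-≤ _ _ (2 ^ e) {{2^-nonZero e}} (begin
  ∑ (2 ^ i) (exceptional e i) * 2 ^ e * 2 ^ e
    ≡⟨ trans (*-assoc (∑ (2 ^ i) (exceptional e i)) (2 ^ e) (2 ^ e)) (cong (∑ (2 ^ i) (exceptional e i) *_) (sym 2^2e)) ⟩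
  ∑ (2 ^ i) (exceptional e i) * 2 ^ (2 * e)
    ≡⟨ cong (_* 2 ^ (2 * e)) (∑-+ (2 ^ i) (λ n → ⟦ n <? 2 ^ (6 * e) ⟧) _) ⟩
  (∑ (2 ^ i) (λ n → ⟦ n <? 2 ^ (6 * e) ⟧) + S₂) * 2 ^ (2 * e)
    ≡⟨ *-distribʳ-+ (2 ^ (2 * e)) (∑ (2 ^ i) (λ n → ⟦ n <? 2 ^ (6 * e) ⟧)) S₂ ⟩
  ∑ (2 ^ i) (λ n → ⟦ n <? 2 ^ (6 * e) ⟧) * 2 ^ (2 * e) + S₂ * 2 ^ (2 * e)
    ≤⟨ +-mono-≤ first second ⟩
  2 ^ i + i * 2 ^ i
    ≤⟨ *-monoˡ-≤ (2 ^ i) (≤-trans i<8e+8 (*-monoʳ-≤ 8 (1+n≤2^n e))) ⟩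
  8 * 2 ^ e * 2 ^ i
    ≡⟨ rearrange (2 ^ e) (2 ^ i) ⟩
  8 * 2 ^ i * 2 ^ e ∎)
  where
  open ≤-Reasoning
  rearrange : ∀ x y → 8 * x * y ≡ 8 * y * x
  rearrange = solve-∀
  2^2e : 2 ^ (2 * e) ≡ 2 ^ e * 2 ^ e
  2^2e = trans (cong (λ x → 2 ^ (e + x)) (+-identityʳ e)) (^-distribˡ-+-* 2 e e)
  S₂ : ℕ
  S₂ = ∑ (2 ^ i) (λ n → ∑ (2 ^ i) (λ b → ⟦ 2 ^ (2 * e) ≤? b ⟧ * ⟦ multiple? (b * b) n ⟧))
  first : ∑ (2 ^ i) (λ n → ⟦ n <? 2 ^ (6 * e) ⟧) * 2 ^ (2 * e) ≤ 2 ^ i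
  first = begin
    ∑ (2 ^ i) (λ n → ⟦ n <? 2 ^ (6 * e) ⟧) * 2 ^ (2 * e) ≤⟨ *-monoˡ-≤ (2 ^ (2 * e)) (∑-⟦<⟧ (2 ^ i) (2 ^ (6 * e))) ⟩
    2 ^ (6 * e) * 2 ^ (2 * e)                            ≡⟨ ^-distribˡ-+-* 2 (6 * e) (2 * e) ⟨
    2 ^ (6 * e + 2 * e)                                  ≡⟨ cong (2 ^_) (*-distribʳ-+ e 6 2) ⟨
    2 ^ (8 * e)                                          ≤⟨ ^-monoʳ-≤ 2 8e≤i ⟩
    2 ^ i                                                ∎
  f : ℕ → ℕ
  f b = ⟦ 2 ^ (2 * e) ≤? b ⟧ * (multiples (2 ^ i) (b * b) * 2 ^ (2 * e))
  -- For b ≥ 2^(2e) one factor of b² absorbs 2^(2e) and the other remains, so a harmonic sum with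
  -- constant weight is left.
  f≤ : ∀ b → f b * b ≤ 2 ^ i
  f≤ b = ≤-trans (≤-reflexive (*-assoc ⟦ 2 ^ (2 * e) ≤? b ⟧ _ b)) (⟦⟧*-≤ (2 ^ (2 * e) ≤? b) λ 2^≤b → begin
    multiples (2 ^ i) (b * b) * 2 ^ (2 * e) * b    ≡⟨ *-assoc (multiples (2 ^ i) (b * b)) _ b ⟩
    multiples (2 ^ i) (b * b) * (2 ^ (2 * e) * b)  ≤⟨ *-monoʳ-≤ (multiples (2 ^ i) (b * b)) (*-monoˡ-≤ b 2^≤b) ⟩
    multiples (2 ^ i) (b * b) * (b * b)            ≤⟨ multiples-upper (2 ^ i) (b * b) ⟩
    2 ^ i                                          ∎)
  f0 : 1 * f 0 ≡ 0
  f0 = trans (*-identityˡ (f 0)) (cong (_* (multiples (2 ^ i) 0 * 2 ^ (2 * e)))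
         (⟦⟧-no (2 ^ (2 * e) ≤? 0) (<⇒≱ (m^n>0 2 (2 * e)))))
  second : S₂ * 2 ^ (2 * e) ≤ i * 2 ^ i
  second = begin
    S₂ * 2 ^ (2 * e)
      ≡⟨ cong (_* 2 ^ (2 * e)) (trans (∑-swap (2 ^ i) (2 ^ i) _) (∑-cong (2 ^ i) λ b → ∑-*ˡ (2 ^ i) ⟦ 2 ^ (2 * e) ≤? b ⟧ _)) ⟩
    ∑ (2 ^ i) (λ b → ⟦ 2 ^ (2 * e) ≤? b ⟧ * multiples (2 ^ i) (b * b)) * 2 ^ (2 * e)
      ≡⟨ ∑-*ʳ (2 ^ i) (2 ^ (2 * e)) _ ⟨
    ∑ (2 ^ i) (λ b → ⟦ 2 ^ (2 * e) ≤? b ⟧ * multiples (2 ^ i) (b * b) * 2 ^ (2 * e))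
      ≡⟨ ∑-cong (2 ^ i) (λ b → trans (*-assoc ⟦ 2 ^ (2 * e) ≤? b ⟧ _ _) (sym (*-identityˡ (f b)))) ⟩
    ∑ (2 ^ i) (λ b → 1 * f b)
      ≤⟨ ∑-harmonic i 1 (2 ^ i) (λ _ → 1) f
           (λ k _ → ≤-reflexive (trans (∑-const (2 ^ k) 1) (*-comm (2 ^ k) 1))) f0 (λ b _ → f≤ b) ⟩
    i * (1 * 2 ^ i)
      ≡⟨ cong (i *_) (*-identityˡ (2 ^ i)) ⟩
    i * 2 ^ i ∎

-- Each step from v to v + 1 gains a factor ≍ j / i ≍ 1 / v from weighting n by logRad n,
-- which beats any fixed B once v is large; smaller v are absorbed by the constant A.
smooth-bound : ∀ β → ∃ λ A → ∀ j → 1 ≤ j → 8 * β ≤ j →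
  ∀ v i → j * v ≤ i → Ψ j i * (2 ^ β) ^ v ≤ A * 2 ^ i
smooth-bound β = A , bound
  where
  open ≤-Reasoning
  B v₀ A : ℕ
  B  = 2 ^ β
  -- Beyond v₀ the inequality j(4B + 1) ≤ ⌊i/8⌋ holds, which drives the induction. In A, the power
  -- B^v₀ settles v ≤ v₀ and the 16 pays for the exceptional n.
  v₀ = 8 * suc (4 * B)
  A  = 16 * B ^ v₀
  instance
    B≢0 : NonZero B
    B≢0 = 2^-nonZero β
  bound : ∀ j → 1 ≤ j → 8 * β ≤ j → ∀ v i → j * v ≤ i → Ψ j i * B ^ v ≤ A * 2 ^ i
  bound j 1≤j 8β≤j = go
    where
    trivial : ∀ v i → v ≤ v₀ → Ψ j i * B ^ v ≤ A * 2 ^ i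
    trivial v i v≤v₀ = begin
      Ψ j i * B ^ v   ≤⟨ *-mono-≤ (Ψ≤2^ j i) (≤-trans (^-monoʳ-≤ B v≤v₀) (m≤n*m (B ^ v₀) 16)) ⟩
      2 ^ i * A       ≡⟨ *-comm (2 ^ i) A ⟩
      A * 2 ^ i       ∎
    go : ∀ v i → j * v ≤ i → Ψ j i * B ^ v ≤ A * 2 ^ i
    go zero    i _    = trivial 0 i z≤n
    go (suc v) i jv≤i with suc v ≤? v₀
    ... | yes v<v₀ = trivial (suc v) i v<v₀
    -- Multiplying by e brings in `logRad`; the 2 splits the target in halves, one for the `logRad`
    -- sum and one for the exceptional n.
    ... | no  v≮v₀ = *-cancelˡ-≤ (2 * e) {{>-nonZero (*-mono-< {0} {2} z<s 0<e)}} (begin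
      2 * e * (Ψ j i * (B * B ^ v))
        ≡⟨ ident₁ e (Ψ j i) B (B ^ v) ⟩
      2 * (e * Ψ j i * (B * B ^ v))
        ≤⟨ *-monoʳ-≤ 2 (*-monoˡ-≤ (B * B ^ v) eΨ≤) ⟩
      2 * ((SL + e * SE) * (B * B ^ v))
        ≡⟨ ident₂ SL e SE B (B ^ v) ⟩
      2 * (SL * B ^ v) * B + 2 * (e * (SE * (B * B ^ v)))
        ≤⟨ +-mono-≤ (*-monoˡ-≤ B (*-monoʳ-≤ 2 SL≤)) (*-monoʳ-≤ 2 (*-monoʳ-≤ e SE≤)) ⟩
      2 * (A * (2 * (2 ^ i * j))) * B + 2 * (e * (8 * 2 ^ i))
        ≡⟨ ident₃ A (2 ^ i) j B e ⟩
      A * 2 ^ i * (j * (4 * B)) + 16 * (e * 2 ^ i)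
        ≤⟨ +-mono-≤ (*-monoʳ-≤ (A * 2 ^ i) 4jB≤e) (*-monoˡ-≤ (e * 2 ^ i) (m≤m*n 16 (B ^ v₀) {{m^n≢0 B v₀}})) ⟩
      A * 2 ^ i * e + A * (e * 2 ^ i)
        ≡⟨ ident₄ A (2 ^ i) e ⟩
      2 * e * (A * 2 ^ i) ∎)
      where
      ident₁ : ∀ e x b y → 2 * e * (x * (b * y)) ≡ 2 * (e * x * (b * y))
      ident₁ = solve-∀
      ident₂ : ∀ s e t b y → 2 * ((s + e * t) * (b * y)) ≡ 2 * (s * y) * b + 2 * (e * (t * (b * y)))
      ident₂ = solve-∀
      ident₃ : ∀ a x j b e → 2 * (a * (2 * (x * j))) * b + 2 * (e * (8 * x)) ≡ a * x * (j * (4 * b)) + 16 * (e * x)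
      ident₃ = solve-∀
      ident₄ : ∀ a x e → a * x * e + a * (e * x) ≡ 2 * e * (a * x)
      ident₄ = solve-∀
      e SL SE : ℕ
      e  = i / 8
      SL = ∑ (2 ^ i) (λ n → ⟦ smooth? j n ⟧ * logRad (2 ^ j) n)
      SE = ∑ (2 ^ i) (exceptional e i)
      8e≤i : 8 * e ≤ i
      8e≤i = ≤-trans (≤-reflexive (*-comm 8 e)) (m/n*n≤m i 8)
      i<8e+8 : i < 8 * suc e
      i<8e+8 = begin-strict
        i               ≡⟨ m≡m%n+[m/n]*n i 8 ⟩
        i % 8 + e * 8   <⟨ +-monoˡ-< (e * 8) (m%n<n i 8) ⟩
        8 + e * 8       ≡⟨ *-comm (suc e) 8 ⟩
        8 * suc e       ∎
      below-e : ∀ c → 8 * c ≤ j * suc v → c ≤ e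
      below-e c 8c≤ = m<1+n⇒m≤n (*-cancelˡ-< 8 c (suc e) (≤-<-trans (≤-trans 8c≤ jv≤i) i<8e+8))
      j[4B+1]≤e : j * suc (4 * B) ≤ e
      j[4B+1]≤e = below-e (j * suc (4 * B)) (begin
        8 * (j * suc (4 * B)) ≡⟨ ident₅ j (4 * B) ⟩
        j * v₀                ≤⟨ *-monoʳ-≤ j (<⇒≤ (≰⇒> v≮v₀)) ⟩
        j * suc v             ∎)
        where
        ident₅ : ∀ j y → 8 * (j * suc y) ≡ j * (8 * suc y)
        ident₅ = solve-∀
      4jB≤e : j * (4 * B) ≤ e
      4jB≤e = ≤-trans (*-monoʳ-≤ j (n≤1+n (4 * B))) j[4B+1]≤e
      0<e : 0 < e
      0<e = ≤-trans (*-mono-≤ 1≤j (s≤s {0} {4 * B} z≤n)) j[4B+1]≤e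
      j≤i : j ≤ i
      j≤i = ≤-trans (m≤m*n j (suc v)) jv≤i
      eΨ≤ : e * Ψ j i ≤ SL + e * SE
      eΨ≤ = begin
        e * Ψ j i
          ≡⟨ ∑-*ˡ (2 ^ i) e _ ⟨
        ∑ (2 ^ i) (λ n → e * ⟦ smooth? j n ⟧)
          ≤⟨ ∑-mono (2 ^ i) (e≤logRad-or-exceptional j e i) ⟩
        ∑ (2 ^ i) (λ n → ⟦ smooth? j n ⟧ * logRad (2 ^ j) n + e * exceptional e i n)
          ≡⟨ ∑-+ (2 ^ i) _ _ ⟩
        SL + ∑ (2 ^ i) (λ n → e * exceptional e i n)
          ≡⟨ cong (SL +_) (∑-*ˡ (2 ^ i) e (exceptional e i)) ⟩
        SL + e * SE ∎
      SL≤ : SL * B ^ v ≤ A * (2 * (2 ^ i * j))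
      -- Removing p lowers i by lg p ≤ j, so j(v + 1) ≤ i leaves j v ≤ i - lg p and the induction
      -- hypothesis for v applies.
      SL≤ = ≤-trans (*-monoˡ-≤ (B ^ v) (∑-smooth-logRad j i j≤i))
        (∑-prime-bound j i A (B ^ v) j≤i λ a a≤j → go v (i ∸ a) (begin
          j * v              ≡⟨ m+n∸m≡n j (j * v) ⟨
          j + j * v ∸ j      ≡⟨ cong (_∸ j) (*-suc j v) ⟨
          j * suc v ∸ j      ≤⟨ ∸-mono jv≤i a≤j ⟩
          i ∸ a              ∎))
      SE≤ : SE * (B * B ^ v) ≤ 8 * 2 ^ i
      -- 8β ≤ j turns j(v + 1) ≤ i into β(v + 1) ≤ e, so B^(v+1) is at most the saving 2^e.
      SE≤ = begin
        SE * B ^ suc v             ≡⟨ cong (SE *_) (^-*-assoc 2 β (suc v)) ⟩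
        SE * 2 ^ (β * suc v)       ≤⟨ *-monoʳ-≤ SE (^-monoʳ-≤ 2 (below-e (β * suc v) (begin
          8 * (β * suc v)   ≡⟨ *-assoc 8 β (suc v) ⟨
          8 * β * suc v     ≤⟨ *-monoˡ-≤ (suc v) 8β≤j ⟩
          j * suc v         ∎))) ⟩
        SE * 2 ^ e                 ≤⟨ ∑-exceptional e i 8e≤i i<8e+8 ⟩
        8 * 2 ^ i                  ∎

-- A majorant of d supported on small divisors

-- The prime list is cut where its product would first reach Y; b is smooth and R is rough with
-- respect to the same p.
record Splitting (Y m : ℕ) : Set where
  field
    b R p        : ℕ
    m≡bR         : m ≡ b * R
    p-prime      : Prime p
    0<b          : 0 < b
    0<R          : 0 < R
    b<Y          : b < Y
    Y≤bp         : Y ≤ b * p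
    b-primes     : ∀ q → Prime q → q ∣ b → q ≤ p
    R-primes     : PrimesFrom p R

-- The least prime of R moves into b until b p ≥ Y; throughout, no prime of b exceeds a prime of R.
-- R = 1 cannot occur, as b < Y ≤ m.
splitting : ∀ Y m → 1 < Y → Y ≤ m → Splitting Y m
splitting Y m 1<Y Y≤m = go m (<-wellFounded m) 1 (sym (*-identityˡ m)) z<s (≤-trans (<⇒≤ 1<Y) Y≤m) 1<Y
  λ q r pq _ q∣1 _ → contradiction (∣⇒≤ q∣1) (<⇒≱ (prime>1 pq))
  where
  go : ∀ R → Acc _<_ R → ∀ b → m ≡ b * R → 0 < b → 0 < R → b < Y →
       (∀ q r → Prime q → Prime r → q ∣ b → r ∣ R → q ≤ r) → Splitting Y m
  go zero _ b m≡bR 0<b () b<Y ordered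
  go 1 _ b m≡bR 0<b 0<R b<Y ordered =
    contradiction (subst (Y ≤_) (trans m≡bR (*-identityʳ b)) Y≤m) (<⇒≱ b<Y)
  go R@(2+ _) (acc rs) b m≡bR 0<b 0<R b<Y ordered with least-prime-factor R (s≤s (s≤s z≤n))
  ... | p , pp , p∣R@(divides R′ R≡R′p) , least with Y ≤? b * p
  ...   | yes Y≤bp = record
    { b = b ; R = R ; p = p ; m≡bR = m≡bR ; p-prime = pp ; 0<b = 0<b ; 0<R = 0<R ; b<Y = b<Y
    ; Y≤bp = Y≤bp ; b-primes = λ q pq q∣b → ordered q p pq pp q∣b p∣R ; R-primes = least }
  ...   | no Y≰bp = go R′ (rs (subst (R′ <_) (sym R≡pR′) (m<p*m pp 0<R′))) (b * p)
      (trans m≡bR (trans (cong (b *_) R≡pR′) (sym (*-assoc b p R′))))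
      (*-mono-< 0<b (<-trans z<s (prime>1 pp))) 0<R′ (≰⇒> Y≰bp) ordered′
    where
    R≡pR′ : R ≡ p * R′
    R≡pR′ = trans R≡R′p (*-comm R′ p)
    0<R′ : 0 < R′
    0<R′ = cofactor>0 p 0<R R≡pR′
    ordered′ : ∀ q r → Prime q → Prime r → q ∣ b * p → r ∣ R′ → q ≤ r
    ordered′ q r pq pr q∣bp r∣R′ with r∣R ← ∣-trans r∣R′ (divides p R≡pR′) | euclidsLemma b p pq q∣bp
    ... | inj₁ q∣b = ordered q r pq pr q∣b r∣R
    ... | inj₂ q∣p = subst (_≤ r) (sym (prime∣prime⇒≡ pp pq q∣p)) (least r pr r∣R)

-- Used for thresholds f t = 2^(j t): the bracket f (t + 1) ≤ p < f t fixes log p up to a factor 2,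
-- and `t ≡ s` is the case of p below the last threshold.
last-above : ∀ (f : ℕ → ℕ) s {p} → p < f 0 →
  ∃ λ t → t ≤ s × p < f t × (t ≡ s ⊎ t < s × f (suc t) ≤ p)
last-above f zero    p<f0 = 0 , z≤n , p<f0 , inj₁ refl
last-above f (suc s) {p} p<f0 with last-above f s p<f0
... | t , t≤s , p<ft , inj₂ (t<s , ft≤p) = t , m≤n⇒m≤1+n t≤s , p<ft , inj₂ (m<n⇒m<1+n t<s , ft≤p)
... | t , t≤s , p<ft , inj₁ refl with p <? f (suc t)
...   | yes p<f = suc t , ≤-refl , p<f , inj₁ refl
...   | no  p≮f = t , n≤1+n t , p<ft , inj₂ (n<1+n t , ≮⇒≥ p≮f)

-- δ ↦ b/δ exchanges the divisors below 2^L with divisors above it.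
d≤2*large-divisors : ∀ L N b → 0 < b → b < N → 2 ^ (2 * L) ≤ b →
  d b ≤ 2 * ∑ N (λ δ → ⟦ 2 ^ L ≤? δ ×-dec δ ∣? b ⟧)
d≤2*large-divisors L N b 0<b b<N 2^2L≤b = begin
  d b
    ≤⟨ d-≤-∑ 0<b b<N ⟩
  ∑ N (λ δ → ⟦ δ ∣? b ⟧)
    ≤⟨ ∑-mono N (λ δ _ → ⟦⟧-≤ (δ ∣? b) (cases δ)) ⟩
  ∑ N (λ δ → ⟦ large? δ ⟧ + ⟦ small? δ ⟧)
    ≡⟨ ∑-+ N _ _ ⟩
  ∑ N (λ δ → ⟦ large? δ ⟧) + ∑ N (λ δ → ⟦ small? δ ⟧)
    ≤⟨ +-monoʳ-≤ (∑ N (λ δ → ⟦ large? δ ⟧)) (count-surj small? large? φ N N preimage) ⟩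
  ∑ N (λ δ → ⟦ large? δ ⟧) + ∑ N (λ δ → ⟦ large? δ ⟧)
    ≡⟨ cong (∑ N (λ δ → ⟦ large? δ ⟧) +_) (+-identityʳ _) ⟨
  2 * ∑ N (λ δ → ⟦ large? δ ⟧) ∎
  where
  open ≤-Reasoning
  large? : ∀ δ → Dec (2 ^ L ≤ δ × δ ∣ b)
  large? δ = 2 ^ L ≤? δ ×-dec δ ∣? b
  small? : ∀ δ → Dec (δ < 2 ^ L × δ ∣ b)
  small? δ = δ <? 2 ^ L ×-dec δ ∣? b
  cases : ∀ δ → δ ∣ b → 1 ≤ ⟦ large? δ ⟧ + ⟦ small? δ ⟧
  cases δ δ∣b with δ <? 2 ^ L
  ... | yes δ< = ≤-trans (≤-reflexive (sym (⟦⟧-yes (yes δ< ×-dec δ ∣? b) (δ< , δ∣b)))) (m≤n+m _ _)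
  ... | no  δ≮ = ≤-trans (≤-reflexive (sym (⟦⟧-yes (large? δ) (≮⇒≥ δ≮ , δ∣b)))) (m≤m+n _ _)
  φ : ℕ → ℕ
  φ zero    = 0
  φ (suc c) = b / suc c
  φ-* : ∀ δ c → 0 < c → b ≡ δ * c → δ ≡ φ c
  φ-* δ (suc c) _ b≡ = trans (sym (m*n/n≡m δ (suc c))) (cong (_/ suc c) (sym b≡))
  preimage : ∀ δ → δ < N → δ < 2 ^ L × δ ∣ b → ∃ λ c → c < N × (2 ^ L ≤ c × c ∣ b) × δ ≡ φ c
  preimage δ _ (δ< , divides c b≡cδ) = c , ≤-<-trans (∣⇒≤ {{>-nonZero 0<b}} c∣b) b<N
    , (≮⇒≥ (λ c< → <⇒≱ (b<2^2L c<) 2^2L≤b) , c∣b) , φ-* δ c (∣⇒>0 0<b c∣b) b≡δc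
    where
    b≡δc : b ≡ δ * c
    b≡δc = trans b≡cδ (*-comm c δ)
    c∣b : c ∣ b
    c∣b = divides δ b≡δc
    b<2^2L : c < 2 ^ L → b < 2 ^ (2 * L)
    b<2^2L c< = begin-strict
      b               ≡⟨ b≡cδ ⟩
      c * δ           <⟨ *-mono-< c< δ< ⟩
      2 ^ L * 2 ^ L   ≡⟨ ^-distribˡ-+-* 2 L L ⟨
      2 ^ (L + L)     ≡⟨ cong (λ x → 2 ^ (L + x)) (+-identityʳ L) ⟨
      2 ^ (2 * L)     ∎

-- Here y = 2^M, and d is majorised below y^k. The thresholds 2^(j t), with j t · 2^t = L, fall from
-- y^(1/4) = 2^L at t = 0 to 2^K at t = s.
module Majorant (k K C A s : ℕ) (1≤K : 1 ≤ K) (0<C : 0 < C)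
  (d^K≤ : ∀ n → 0 < n → d n ^ K ≤ C * n)
  (Ψ≤ : ∀ j → K ≤ j → ∀ v i → j * v ≤ i → Ψ j i * (2 ^ suc (8 * k)) ^ v ≤ A * 2 ^ i)
  where

  open ≤-Reasoning

  L M : ℕ
  L = K * 2 ^ s
  M = 4 * L

  j : ℕ → ℕ
  j t = K * 2 ^ (s ∸ t)

  -- A bound for d(R) at level t. The exponent is 4k · 2^(t+1), from p ≥ 2^(j (t+1)); the factor C
  -- serves the last level.
  W : ℕ → ℕ
  W t = C * 2 ^ (8 * k * 2 ^ t)

  bigSmooth? : ∀ t δ → Dec (2 ^ L ≤ δ × Smooth (j t) δ)
  bigSmooth? t δ = 2 ^ L ≤? δ ×-dec smooth? (j t) δ

  -- The constant term serves p ≥ 2^L, the t-th summand the primes p of level t; its 2 comes from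
  -- `d≤2*large-divisors`.
  w : ℕ → ℕ
  w δ = 2 ^ (4 * k) + ∑ (suc s) (λ t → 2 * W t * ⟦ bigSmooth? t δ ⟧)

  private
    K≤j : ∀ t → K ≤ j t
    K≤j t = m≤m*n K (2 ^ (s ∸ t)) {{2^-nonZero (s ∸ t)}}

    j*2^t : ∀ {t} → t ≤ s → j t * 2 ^ t ≡ L
    j*2^t {t} t≤s = trans (*-assoc K (2 ^ (s ∸ t)) (2 ^ t))
      (cong (K *_) (trans (sym (^-distribˡ-+-* 2 (s ∸ t) t)) (cong (2 ^_) (m∸n+n≡m t≤s))))

    kM≡ : ∀ {t} → t ≤ s → k * M ≡ 4 * k * 2 ^ t * j t
    kM≡ {t} t≤s = trans (cong (λ x → k * (4 * x)) (sym (j*2^t t≤s))) (rearrange k (2 ^ t) (j t))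
      where
      rearrange : ∀ k x y → k * (4 * (y * x)) ≡ 4 * k * x * y
      rearrange = solve-∀

    -- The root of order j t is taken in d(R)^(j t) ≤ R < 2^(kM), where kM = 4k · 2^t · j t.
    rough-d≤ : ∀ {t R} → t ≤ s → 0 < R → R < 2 ^ (k * M) → PrimesFrom (2 ^ j t) R →
               d R ≤ 2 ^ (4 * k * 2 ^ t)
    rough-d≤ {t} {R} t≤s 0<R R< from = ≤-trans
      (root-bound (j t) {{>-nonZero (≤-trans 1≤K (K≤j t))}} {C = 1} {n = R} {e = 4 * k * 2 ^ t} z<s
        (≤-trans (d^q≤n (j t) R 0<R from) (≤-reflexive (sym (*-identityˡ R))))
        (≤-trans (<⇒≤ R<) (≤-reflexive (cong (2 ^_) (kM≡ t≤s)))))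
      (≤-reflexive (*-identityˡ _))

    base≤w : ∀ δ → 2 ^ (4 * k) ≤ w δ
    base≤w δ = m≤m+n _ _

    W≤w : ∀ {t} δ → t ≤ s → 2 * W t * ⟦ bigSmooth? t δ ⟧ ≤ w δ
    W≤w {t} δ t≤s = ≤-trans (∑-point (suc s) (λ t → 2 * W t * ⟦ bigSmooth? t δ ⟧) (s≤s t≤s)) (m≤n+m _ (2 ^ (4 * k)))

  majorant : ∀ m → 0 < m → m < 2 ^ (k * M) → d m ≤ ∑ (2 ^ M) (λ δ → w δ * ⟦ δ ∣? m ⟧)
  majorant m 0<m m<2^kM with m <? 2 ^ M
  -- All divisors of m are in range and w ≥ 1.
  ... | yes m<2^M = ≤-trans (d-≤-∑ 0<m m<2^M) (∑-mono (2 ^ M) λ δ _ →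
    m≤n*m ⟦ δ ∣? m ⟧ (w δ) {{>-nonZero (≤-trans (m^n>0 2 (4 * k)) (base≤w δ))}})
  ... | no  m≮2^M = split (2 ^ j 0 ≤? p)
    where
    1<2^M : 1 < 2 ^ M
    1<2^M = ^-monoʳ-< 2 (s≤s (s≤s z≤n)) {0} {M} (*-mono-< {0} {4} z<s (*-mono-< 1≤K (m^n>0 2 s)))
    open Splitting (splitting (2 ^ M) m 1<2^M (≮⇒≥ m≮2^M))
    b∣m : b ∣ m
    b∣m = divides R (trans m≡bR (*-comm b R))
    R<2^kM : R < 2 ^ (k * M)
    R<2^kM = ≤-<-trans (∣⇒≤ {{>-nonZero 0<m}} (divides b m≡bR)) m<2^kM
    dm≤ : d m ≤ d b * d R
    dm≤ = subst (λ x → d x ≤ d b * d R) (sym m≡bR) (d-submultiplicative 0<b 0<R)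
    split : Dec (2 ^ j 0 ≤ p) → d m ≤ ∑ (2 ^ M) (λ δ → w δ * ⟦ δ ∣? m ⟧)
    split (yes 2^j≤p) = begin
      d m
        ≤⟨ dm≤ ⟩
      d b * d R
        ≤⟨ *-mono-≤ (d-≤-∑ 0<b b<Y)
             (rough-d≤ {0} z≤n 0<R R<2^kM λ q pq q∣R → ≤-trans 2^j≤p (R-primes q pq q∣R)) ⟩
      ∑ (2 ^ M) (λ δ → ⟦ δ ∣? b ⟧) * 2 ^ (4 * k * 1)
        ≡⟨ cong (λ x → ∑ (2 ^ M) (λ δ → ⟦ δ ∣? b ⟧) * 2 ^ x) (*-identityʳ (4 * k)) ⟩
      ∑ (2 ^ M) (λ δ → ⟦ δ ∣? b ⟧) * 2 ^ (4 * k)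
        ≡⟨ ∑-*ʳ (2 ^ M) (2 ^ (4 * k)) _ ⟨
      ∑ (2 ^ M) (λ δ → ⟦ δ ∣? b ⟧ * 2 ^ (4 * k))
        ≤⟨ ∑-mono (2 ^ M) (λ δ _ → begin
             ⟦ δ ∣? b ⟧ * 2 ^ (4 * k) ≤⟨ *-mono-≤ (⟦⟧-mono (δ ∣? b) (δ ∣? m) (λ δ∣b → ∣-trans δ∣b b∣m)) (base≤w δ) ⟩
             ⟦ δ ∣? m ⟧ * w δ         ≡⟨ *-comm ⟦ δ ∣? m ⟧ (w δ) ⟩
             w δ * ⟦ δ ∣? m ⟧         ∎) ⟩
      ∑ (2 ^ M) (λ δ → w δ * ⟦ δ ∣? m ⟧) ∎
    -- Now p < 2^L, which forces b ≥ 2^(2L). At least half of the divisors of b are then ≥ 2^L, and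
    -- all are 2^(j t)-smooth for the level t of p.
    split (no 2^j≰p) with last-above (λ t → 2 ^ j t) s (≰⇒> 2^j≰p)
    ... | t , t≤s , p<2^j , which = begin
      d m
        ≤⟨ dm≤ ⟩
      d b * d R
        ≤⟨ *-mono-≤ (d≤2*large-divisors L (2 ^ M) b 0<b b<Y 2^2L≤b) (dR≤W which) ⟩
      2 * ∑ (2 ^ M) G * W t
        ≡⟨ rearrange (∑ (2 ^ M) G) (W t) ⟩
      2 * W t * ∑ (2 ^ M) G
        ≡⟨ ∑-*ˡ (2 ^ M) (2 * W t) G ⟨
      ∑ (2 ^ M) (λ δ → 2 * W t * G δ)
        ≤⟨ ∑-mono (2 ^ M) (λ δ _ → begin
             2 * W t * G δ
               ≤⟨ *-monoʳ-≤ (2 * W t) (G≤ δ) ⟩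
             2 * W t * (⟦ bigSmooth? t δ ⟧ * ⟦ δ ∣? m ⟧)
               ≡⟨ *-assoc (2 * W t) ⟦ bigSmooth? t δ ⟧ ⟦ δ ∣? m ⟧ ⟨
             2 * W t * ⟦ bigSmooth? t δ ⟧ * ⟦ δ ∣? m ⟧
               ≤⟨ *-monoˡ-≤ ⟦ δ ∣? m ⟧ (W≤w δ t≤s) ⟩
             w δ * ⟦ δ ∣? m ⟧ ∎) ⟩
      ∑ (2 ^ M) (λ δ → w δ * ⟦ δ ∣? m ⟧) ∎
      where
      rearrange : ∀ x y → 2 * x * y ≡ 2 * y * x
      rearrange = solve-∀
      G : ℕ → ℕ
      G δ = ⟦ 2 ^ L ≤? δ ×-dec δ ∣? b ⟧
      b-smooth : Smooth (j t) b
      b-smooth = below⇒smooth (j t) 0<b λ q pq q∣b → ≤-<-trans (b-primes q pq q∣b) p<2^j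
      G≤ : ∀ δ → G δ ≤ ⟦ bigSmooth? t δ ⟧ * ⟦ δ ∣? m ⟧
      G≤ δ = ≤-trans
        (⟦⟧-mono (2 ^ L ≤? δ ×-dec δ ∣? b) (bigSmooth? t δ ×-dec δ ∣? m)
          λ (2^L≤δ , δ∣b) → (2^L≤δ , smooth-∣ (j t) δ∣b b-smooth) , ∣-trans δ∣b b∣m)
        (≤-reflexive (⟦⟧-× (bigSmooth? t δ) (δ ∣? m)))
      j≤L : j t ≤ L
      j≤L = *-monoʳ-≤ K (^-monoʳ-≤ 2 (m∸n≤m s t))
      2^2L≤b : 2 ^ (2 * L) ≤ b
      2^2L≤b = *-cancelʳ-≤ _ _ (2 ^ (2 * L)) {{2^-nonZero (2 * L)}} (begin
        2 ^ (2 * L) * 2 ^ (2 * L) ≡⟨ ^-distribˡ-+-* 2 (2 * L) (2 * L) ⟨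
        2 ^ (2 * L + 2 * L)       ≡⟨ cong (2 ^_) (*-distribʳ-+ L 2 2) ⟨
        2 ^ M                     ≤⟨ Y≤bp ⟩
        b * p                     ≤⟨ *-monoʳ-≤ b (<⇒≤ p<2^j) ⟩
        b * 2 ^ j t               ≤⟨ *-monoʳ-≤ b (^-monoʳ-≤ 2 (≤-trans j≤L (m≤n*m L 2))) ⟩
        b * 2 ^ (2 * L)           ∎)
      dR≤W : t ≡ s ⊎ t < s × 2 ^ j (suc t) ≤ p → d R ≤ W t
      -- At the last level p has no useful lower bound; the general divisor bound with exponent K =
      -- j s takes the place of roughness.
      dR≤W (inj₁ refl) = begin
        d R                       ≤⟨ root-bound K {{>-nonZero 1≤K}} {e = 4 * k * 2 ^ s} 0<C (d^K≤ R 0<R)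
                                       (≤-trans (<⇒≤ R<2^kM) (≤-reflexive (cong (2 ^_) (trans (kM≡ ≤-refl)
                                         (cong (4 * k * 2 ^ s *_) (trans (cong (λ x → K * 2 ^ x) (n∸n≡0 s)) (*-identityʳ K))))))) ⟩
        C * 2 ^ (4 * k * 2 ^ s)   ≤⟨ *-monoʳ-≤ C (^-monoʳ-≤ 2 (*-monoˡ-≤ (2 ^ s) (*-monoˡ-≤ k 4≤8))) ⟩
        W s                       ∎
        where
        4≤8 : 4 ≤ 8
        4≤8 = s≤s (s≤s (s≤s (s≤s z≤n)))
      dR≤W (inj₂ (t<s , 2^j≤p)) = begin
        d R                           ≤⟨ rough-d≤ t<s 0<R R<2^kM (λ q pq q∣R → ≤-trans 2^j≤p (R-primes q pq q∣R)) ⟩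
        2 ^ (4 * k * (2 * 2 ^ t))     ≡⟨ cong (2 ^_) (double k (2 ^ t)) ⟩
        2 ^ (8 * k * 2 ^ t)           ≤⟨ m≤n*m _ C {{>-nonZero 0<C}} ⟩
        W t                           ∎
        where
        double : ∀ k x → 4 * k * (2 * x) ≡ 8 * k * x
        double = solve-∀

  w-const : ℕ
  w-const = 2 ^ (4 * k) + 8 * (C * A)

  -- The smooth number bound with v = 2^t saves (2^(8k+1))^v, which beats W t by 2^(2^t) ≥ 2^t. The
  -- levels thus form a geometric series.
  w-block : ∀ i → ∑ (2 ^ i) (λ r → w (2 ^ i + r)) ≤ w-const * 2 ^ i
  w-block i = begin
    ∑ (2 ^ i) (λ r → w (2 ^ i + r))
      ≡⟨ ∑-+ (2 ^ i) (λ _ → 2 ^ (4 * k)) _ ⟩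
    ∑ (2 ^ i) (λ _ → 2 ^ (4 * k)) + ∑ (2 ^ i) (λ r → ∑ (suc s) λ t → 2 * W t * ⟦ bigSmooth? t (2 ^ i + r) ⟧)
      ≡⟨ cong₂ _+_ (trans (∑-const (2 ^ i) (2 ^ (4 * k))) (*-comm (2 ^ i) (2 ^ (4 * k))))
           (trans (∑-swap (2 ^ i) (suc s) _) (∑-cong (suc s) λ t → ∑-*ˡ (2 ^ i) (2 * W t) _)) ⟩
    2 ^ (4 * k) * 2 ^ i + ∑ (suc s) (λ t → 2 * W t * N t)
      ≤⟨ +-monoʳ-≤ (2 ^ (4 * k) * 2 ^ i) (∑-geometric (suc s) (4 * (C * A) * 2 ^ i) _
           λ t t<s → level t (m<1+n⇒m≤n t<s)) ⟩
    2 ^ (4 * k) * 2 ^ i + 2 * (4 * (C * A) * 2 ^ i)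
      ≡⟨ collect (2 ^ (4 * k)) (C * A) (2 ^ i) ⟩
    w-const * 2 ^ i ∎
    where
    collect : ∀ a b x → a * x + 2 * (4 * b * x) ≡ (a + 8 * b) * x
    collect = solve-∀
    N : ℕ → ℕ
    N t = ∑ (2 ^ i) (λ r → ⟦ bigSmooth? t (2 ^ i + r) ⟧)
    -- Blocks below 2^L carry only the constant weight; for i ≥ L the condition j t · 2^t = L ≤ i +
    -- 1 of the smooth number bound holds.
    block-small : i < L → ∀ t r → r < 2 ^ i → ⟦ bigSmooth? t (2 ^ i + r) ⟧ ≤ 0
    block-small i<L t r r< = ⟦⟧-≤ (bigSmooth? t (2 ^ i + r)) λ (2^L≤ , _) → contradiction 2^L≤ (<⇒≱ (begin-strict
      2 ^ i + r      <⟨ +-monoʳ-< (2 ^ i) r< ⟩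
      2 ^ i + 2 ^ i  ≡⟨ 2^-double i ⟨
      2 ^ suc i      ≤⟨ ^-monoʳ-≤ 2 i<L ⟩
      2 ^ L          ∎))
    N≤Ψ : ∀ t → N t ≤ Ψ (j t) (suc i)
    N≤Ψ t = begin
      N t
        ≤⟨ ∑-mono (2 ^ i) (λ r _ → ⟦⟧-mono (bigSmooth? t (2 ^ i + r)) (smooth? (j t) (2 ^ i + r)) proj₂) ⟩
      ∑ (2 ^ i) (λ r → ⟦ smooth? (j t) (2 ^ i + r) ⟧)
        ≤⟨ m≤n+m _ _ ⟩
      ∑ (2 ^ i) (λ n → ⟦ smooth? (j t) n ⟧) + ∑ (2 ^ i) (λ r → ⟦ smooth? (j t) (2 ^ i + r) ⟧)
        ≡⟨ ∑-split (2 ^ i) (2 ^ i) (λ n → ⟦ smooth? (j t) n ⟧) ⟨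
      ∑ (2 ^ i + 2 ^ i) (λ n → ⟦ smooth? (j t) n ⟧)
        ≡⟨ cong (λ x → ∑ x (λ n → ⟦ smooth? (j t) n ⟧)) (2^-double i) ⟨
      Ψ (j t) (suc i) ∎
    level : ∀ t → t ≤ s → 2 * W t * N t * 2 ^ t ≤ 4 * (C * A) * 2 ^ i
    level t t≤s with i <? L
    ... | yes i<L = begin
      2 * W t * N t * 2 ^ t   ≤⟨ *-monoˡ-≤ (2 ^ t) (*-monoʳ-≤ (2 * W t) (∑-bounded (2 ^ i) 0 (block-small i<L t))) ⟩
      2 * W t * (2 ^ i * 0) * 2 ^ t ≡⟨ vanish (2 * W t) (2 ^ i) (2 ^ t) ⟩
      0                       ≤⟨ z≤n ⟩
      4 * (C * A) * 2 ^ i     ∎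
      where
      vanish : ∀ a b c → a * (b * 0) * c ≡ 0
      vanish = solve-∀
    ... | no i≮L = begin
      2 * W t * N t * 2 ^ t
        ≤⟨ *-mono-≤ (*-monoʳ-≤ (2 * W t) (N≤Ψ t)) (^-monoʳ-≤ 2 (<⇒≤ (1+n≤2^n t))) ⟩
      2 * W t * Ψ (j t) (suc i) * 2 ^ (2 ^ t)
        ≡⟨ rearrange C (2 ^ (8 * k * 2 ^ t)) (Ψ (j t) (suc i)) (2 ^ (2 ^ t)) ⟩
      2 * (C * (Ψ (j t) (suc i) * (2 ^ (2 ^ t) * 2 ^ (8 * k * 2 ^ t))))
        ≡⟨ cong (λ x → 2 * (C * (Ψ (j t) (suc i) * x)))
             (trans (sym (^-distribˡ-+-* 2 (2 ^ t) (8 * k * 2 ^ t))) (sym (^-*-assoc 2 (suc (8 * k)) (2 ^ t)))) ⟩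
      2 * (C * (Ψ (j t) (suc i) * (2 ^ suc (8 * k)) ^ (2 ^ t)))
        ≤⟨ *-monoʳ-≤ 2 (*-monoʳ-≤ C (Ψ≤ (j t) (K≤j t) (2 ^ t) (suc i)
             (≤-trans (≤-reflexive (j*2^t t≤s)) (m≤n⇒m≤1+n (≮⇒≥ i≮L))))) ⟩
      2 * (C * (A * (2 * 2 ^ i)))
        ≡⟨ collect′ C A (2 ^ i) ⟩
      4 * (C * A) * 2 ^ i ∎
      where
      rearrange : ∀ c x y z → 2 * (c * x) * y * z ≡ 2 * (c * (y * (z * x)))
      rearrange = solve-∀
      collect′ : ∀ c a x → 2 * (c * (a * (2 * x))) ≡ 4 * (c * a) * x
      collect′ = solve-∀

-- Triple correlations

-- Solutions are at least P / c apart. The induction remembers the last solution l, and the extra P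
-- accounts for the first one.
separated-count : ∀ {q} {Q : ℕ → Set q} (Q? : ∀ n → Dec (Q n)) P c →
  (∀ n D → 0 < D → Q n → Q (n + D) → P ≤ c * D) →
  ∀ x → ∑ x (λ n → ⟦ Q? n ⟧) * P ≤ c * x + P
separated-count {Q = Q} Q? P c sep x with go x
  where
  open ≤-Reasoning
  count : ℕ → ℕ
  count x = ∑ x (λ n → ⟦ Q? n ⟧)
  go : ∀ x → count x ≡ 0 ⊎ (∃ λ l → l < x × Q l × count x * P ≤ c * l + P)
  go zero = inj₁ refl
  go (suc x) with Q? x | go x
  ... | no _   | inj₁ none = inj₁ (trans (+-identityʳ (count x)) none)
  ... | no _   | inj₂ (l , l<x , Ql , bound) =
    inj₂ (l , m<n⇒m<1+n l<x , Ql , ≤-trans (*-monoˡ-≤ P (≤-reflexive (+-identityʳ (count x)))) bound)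
  ... | yes Qx | inj₁ none = inj₂ (x , n<1+n x , Qx , (begin
    (count x + 1) * P  ≡⟨ cong (λ y → (y + 1) * P) none ⟩
    1 * P              ≡⟨ *-identityˡ P ⟩
    P                  ≤⟨ m≤n+m P (c * x) ⟩
    c * x + P          ∎))
  ... | yes Qx | inj₂ (l , l<x , Ql , bound) = inj₂ (x , n<1+n x , Qx , (begin
    (count x + 1) * P        ≡⟨ *-distribʳ-+ P (count x) 1 ⟩
    count x * P + 1 * P      ≡⟨ cong (count x * P +_) (*-identityˡ P) ⟩
    count x * P + P          ≤⟨ +-mono-≤ bound (sep l (x ∸ l) (m<n⇒0<n∸m l<x) Ql (subst Q (sym l+) Qx)) ⟩
    c * l + P + c * (x ∸ l)  ≡⟨ rearrange (c * l) P (c * (x ∸ l)) ⟩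
    c * l + c * (x ∸ l) + P  ≡⟨ cong (_+ P) (*-distribˡ-+ c l (x ∸ l)) ⟨
    c * (l + (x ∸ l)) + P    ≡⟨ cong (λ y → c * y + P) l+ ⟩
    c * x + P                ∎))
    where
    l+ : l + (x ∸ l) ≡ x
    l+ = m+[n∸m]≡n (<⇒≤ l<x)
    rearrange : ∀ x y z → x + y + z ≡ x + z + y
    rearrange = solve-∀
... | inj₁ none = ≤-trans (≤-reflexive (cong (_* P) none)) z≤n
... | inj₂ (l , l<x , _ , bound) = ≤-trans bound (+-monoˡ-≤ P (*-monoʳ-≤ c (<⇒≤ l<x)))

∣m+n∣n⇒∣m : ∀ {i m n} → i ∣ m + n → i ∣ n → i ∣ m
∣m+n∣n⇒∣m {i} {m} {n} i∣m+n = ∣m+n∣m⇒∣n (subst (i ∣_) (+-comm m n) i∣m+n)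

distance : ∀ n h → (n ≡ h + ∣ n - h ∣) ⊎ (h ≡ n + ∣ n - h ∣)
distance n h with ≤-total h n
... | inj₁ h≤n = inj₁ (sym (trans (cong (h +_) (m≤n⇒∣n-m∣≡n∸m h≤n)) (m+[n∸m]≡n h≤n)))
... | inj₂ n≤h = inj₂ (sym (trans (cong (n +_) (m≤n⇒∣m-n∣≡n∸m n≤h)) (m+[n∸m]≡n n≤h)))

-- D is the difference of the signed numbers n + D - h and n - h; the cases recover the signs that
-- the absolute values hide.
∣-gap : ∀ {b} n h D → b ∣ ∣ n - h ∣ → b ∣ ∣ n + D - h ∣ → b ∣ D
∣-gap {b} n h D b∣e b∣e′ with distance n h | distance (n + D) h
... | inj₁ n≡ | inj₁ n+D≡ = ∣m+n∣m⇒∣n (subst (b ∣_) (+-cancelˡ-≡ h e′ (e + D) eq) b∣e′) b∣e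
  where
  e e′ : ℕ
  e  = ∣ n - h ∣
  e′ = ∣ n + D - h ∣
  eq : h + e′ ≡ h + (e + D)
  eq = trans (sym n+D≡) (trans (cong (_+ D) n≡) (+-assoc h e D))
... | inj₁ n≡ | inj₂ h≡ = subst (b ∣_) (sym D≡0) (b ∣0)
  where
  n+D≤n : n + D ≤ n
  n+D≤n = ≤-trans (≤-trans (m≤m+n (n + D) _) (≤-reflexive (sym h≡)))
                  (≤-trans (m≤m+n h ∣ n - h ∣) (≤-reflexive (sym n≡)))
  D≡0 : D ≡ 0
  D≡0 = n≤0⇒n≡0 (+-cancelˡ-≤ n D 0 (≤-trans n+D≤n (≤-reflexive (sym (+-identityʳ n)))))
... | inj₂ h≡ | inj₁ n+D≡ = subst (b ∣_) (sym D≡) (∣m∣n⇒∣m+n b∣e b∣e′)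
  where
  D≡ : D ≡ ∣ n - h ∣ + ∣ n + D - h ∣
  D≡ = +-cancelˡ-≡ n _ _ (trans n+D≡ (trans (cong (_+ ∣ n + D - h ∣) h≡) (+-assoc n _ _)))
... | inj₂ h≡ | inj₂ h≡′ = ∣m+n∣n⇒∣m (subst (b ∣_) e≡ b∣e) b∣e′
  where
  e≡ : ∣ n - h ∣ ≡ D + ∣ n + D - h ∣
  e≡ = +-cancelˡ-≡ n _ _ (trans (sym h≡) (trans h≡′ (+-assoc n D _)))

-- With e = n − h one has  h = n − e  and  2h² = n e − (n + h)(n − 2h).
-- The signs are distributed so that no subtraction occurs.
ab∣hD : ∀ {n h e a b D} → (n ≡ h + e) ⊎ (h ≡ n + e) → a ∣ n → b ∣ e → a ∣ D → b ∣ D → a * b ∣ h * D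
ab∣hD {n} {h} {e} {a} {b} {D} sides a∣n b∣e a∣D b∣D = cases sides
  where
  ab∣nD : a * b ∣ n * D
  ab∣nD = *-pres-∣ a∣n b∣D
  ab∣eD : a * b ∣ e * D
  ab∣eD = subst (a * b ∣_) (*-comm D e) (*-pres-∣ a∣D b∣e)
  cases : (n ≡ h + e) ⊎ (h ≡ n + e) → a * b ∣ h * D
  cases (inj₁ n≡) = ∣m+n∣n⇒∣m (subst (a * b ∣_) (trans (cong (_* D) n≡) (*-distribʳ-+ D h e)) ab∣nD) ab∣eD
  cases (inj₂ h≡) = subst (a * b ∣_) (trans (sym (*-distribʳ-+ D n e)) (cong (_* D) (sym h≡))) (∣m∣n⇒∣m+n ab∣nD ab∣eD)

-- The identity for 2h² is multiplied by h D. In n e · h D the factors supply a, b and c in turn; in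
-- the other term h D supplies a b and n + h supplies c.
abc∣2h³D : ∀ {n h e a b c D} → (n ≡ h + e) ⊎ (h ≡ n + e) →
           a ∣ n → b ∣ e → c ∣ n + h → a ∣ D → b ∣ D → c ∣ D →
           a * b * c ∣ 2 * (h * h) * (h * D)
abc∣2h³D {n} {h} {e} {a} {b} {c} {D} sides a∣n b∣e c∣n+h a∣D b∣D c∣D = cases sides
  where
  hD : ℕ
  hD = h * D
  ab∣ : a * b ∣ hD
  ab∣ = ab∣hD sides a∣n b∣e a∣D b∣D
  div₁ : a * b * c ∣ n * e * hD
  div₁ = *-pres-∣ (*-pres-∣ a∣n b∣e) (∣n⇒∣m*n h c∣D)
  div₂ : ∀ y → a * b * c ∣ y * (hD * (n + h))
  div₂ y = ∣n⇒∣m*n y (*-pres-∣ ab∣ c∣n+h)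
  cases : (n ≡ h + e) ⊎ (h ≡ n + e) → a * b * c ∣ 2 * (h * h) * hD
  cases (inj₁ refl) = ∣m+n∣n⇒∣m
    (subst (a * b * c ∣_) (ident h e hD) (∣m∣n⇒∣m+n div₁ (div₂ (2 * h)))) (div₂ n)
    where
    ident : ∀ h e x → (h + e) * e * x + 2 * h * (x * (h + e + h)) ≡ 2 * (h * h) * x + (h + e) * (x * (h + e + h))
    ident = solve-∀
  cases (inj₂ refl) = ∣m+n∣n⇒∣m
    (subst (a * b * c ∣_) (ident n e hD) (div₂ (2 * h))) (∣m∣n⇒∣m+n (div₂ n) div₁)
    where
    ident : ∀ n e x → 2 * (n + e) * (x * (n + (n + e)))
                    ≡ 2 * ((n + e) * (n + e)) * x + (n * (x * (n + (n + e))) + n * e * x)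
    ident = solve-∀

-- Simultaneous divisibility of n, n - h and n + h

Triple : (h a b c k : ℕ) → Set
Triple h a b c k = a ∣ suc k × b ∣ ∣ suc k - h ∣ × c ∣ suc k + h

triple? : ∀ h a b c k → Dec (Triple h a b c k)
triple? h a b c k = a ∣? suc k ×-dec b ∣? ∣ suc k - h ∣ ×-dec c ∣? suc k + h

-- The difference D of two solutions is divisible by a, b and c, so a b c divides 2h³D and D ≥ a b c
-- / 2h³. The condition a b c ≤ x absorbs the first solution.
triple-count : ∀ h a b c x → 0 < h → a * b * c ≤ x →
  ∑ x (λ k → ⟦ triple? h a b c k ⟧) * (a * b * c) ≤ suc (2 * (h * h) * h) * x
triple-count h a b c x 0<h abc≤x = begin
  ∑ x (λ k → ⟦ triple? h a b c k ⟧) * (a * b * c)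
    ≤⟨ separated-count (triple? h a b c) (a * b * c) (2 * (h * h) * h) separated x ⟩
  2 * (h * h) * h * x + a * b * c
    ≤⟨ +-monoʳ-≤ (2 * (h * h) * h * x) abc≤x ⟩
  2 * (h * h) * h * x + x
    ≡⟨ +-comm (2 * (h * h) * h * x) x ⟩
  suc (2 * (h * h) * h) * x ∎
  where
  open ≤-Reasoning
  separated : ∀ k D → 0 < D → Triple h a b c k → Triple h a b c (k + D) → a * b * c ≤ 2 * (h * h) * h * D
  separated k D 0<D (a∣n , b∣e , c∣n+h) (a∣n′ , b∣e′ , c∣n′+h) = ∣⇒≤ {{>-nonZero positive}}
    (subst (a * b * c ∣_) (sym (*-assoc (2 * (h * h)) h D))
      (abc∣2h³D (distance (suc k) h) a∣n b∣e c∣n+h (∣m+n∣m⇒∣n a∣n′ a∣n) (∣-gap (suc k) h D b∣e b∣e′)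
        (∣m+n∣m⇒∣n (subst (c ∣_) (rearrange (suc k) D h) c∣n′+h) c∣n+h)))
    where
    rearrange : ∀ n D h → n + D + h ≡ n + h + D
    rearrange = solve-∀
    positive : 0 < 2 * (h * h) * h * D
    positive = *-mono-< (*-mono-< (*-mono-< {0} {2} z<s (*-mono-< 0<h 0<h)) 0<h) 0<D

-- Expanding the sum over three majorants

sum-filter-suc-upTo : ∀ {p} {P : ℕ → Set p} (P? : ∀ n → Dec (P n)) (f : ℕ → ℕ) x →
  sum (map f (filter P? (map suc (upTo x)))) ≤ ∑ x (λ k → f (suc k))
sum-filter-suc-upTo P? f zero    = z≤n
sum-filter-suc-upTo P? f (suc x) = begin
  sum (map f (filter P? (map suc (upTo (suc x)))))
    ≡⟨ cong (λ l → sum (map f (filter P? (map suc l)))) (sym (upTo-∷ʳ x)) ⟩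
  sum (map f (filter P? (map suc (upTo x ∷ʳ x))))
    ≡⟨ cong (λ l → sum (map f (filter P? l))) (map-++ suc (upTo x) (x ∷ [])) ⟩
  sum (map f (filter P? (map suc (upTo x) ∷ʳ suc x)))
    ≡⟨ cong (λ l → sum (map f l)) (filter-++ P? (map suc (upTo x)) (suc x ∷ [])) ⟩
  sum (map f (filter P? (map suc (upTo x)) ++ filter P? (suc x ∷ [])))
    ≡⟨ cong sum (map-++ f (filter P? (map suc (upTo x))) _) ⟩
  sum (map f (filter P? (map suc (upTo x))) ++ map f (filter P? (suc x ∷ [])))
    ≡⟨ sum-++ (map f (filter P? (map suc (upTo x)))) _ ⟩
  sum (map f (filter P? (map suc (upTo x)))) + sum (map f (filter P? (suc x ∷ [])))
    ≤⟨ +-mono-≤ (sum-filter-suc-upTo P? f x) singleton ⟩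
  ∑ x (λ k → f (suc k)) + f (suc x) ∎
  where
  open ≤-Reasoning
  singleton : sum (map f (filter P? (suc x ∷ []))) ≤ f (suc x)
  singleton with P? (suc x)
  ... | yes _ = ≤-reflexive (+-identityʳ _)
  ... | no  _ = z≤n

∑-product : ∀ N f g → ∑ N f * ∑ N g ≡ ∑ N (λ a → ∑ N (λ b → f a * g b))
∑-product N f g = trans (sym (∑-*ʳ N (∑ N g) f)) (∑-cong N λ a → sym (∑-*ˡ N (f a) g))

∑-triple-majorant : ∀ x N (u : ℕ → ℕ) h →
  ∑ x (λ k → ∑ N (λ a → u a * ⟦ a ∣? suc k ⟧) * ∑ N (λ b → u b * ⟦ b ∣? ∣ suc k - h ∣ ⟧)
               * ∑ N (λ c → u c * ⟦ c ∣? suc k + h ⟧))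
    ≡ ∑ N (λ a → u a * ∑ N λ b → u b * ∑ N λ c → u c * ∑ x λ k → ⟦ triple? h a b c k ⟧)
∑-triple-majorant x N u h = begin
  ∑ x (λ k → ∑ N (F k) * ∑ N (G k) * ∑ N (H k))
    ≡⟨ ∑-cong x (λ k → expand k) ⟩
  ∑ x (λ k → ∑ N λ a → ∑ N λ b → ∑ N λ c → F k a * (G k b * H k c))
    ≡⟨ ∑-swap x N _ ⟩
  ∑ N (λ a → ∑ x λ k → ∑ N λ b → ∑ N λ c → F k a * (G k b * H k c))
    ≡⟨ ∑-cong N (λ a → ∑-swap x N _) ⟩
  ∑ N (λ a → ∑ N λ b → ∑ x λ k → ∑ N λ c → F k a * (G k b * H k c))
    ≡⟨ ∑-cong N (λ a → ∑-cong N λ b → ∑-swap x N _) ⟩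
  ∑ N (λ a → ∑ N λ b → ∑ N λ c → ∑ x λ k → F k a * (G k b * H k c))
    ≡⟨ ∑-cong N (λ a → ∑-cong N λ b → ∑-cong N λ c → collect a b c) ⟩
  ∑ N (λ a → ∑ N λ b → ∑ N λ c → u a * (u b * (u c * count a b c)))
    ≡⟨ ∑-cong N (λ a → trans (∑-cong N λ b → trans (∑-*ˡ N (u a) _) (cong (u a *_) (∑-*ˡ N (u b) _))) (∑-*ˡ N (u a) _)) ⟩
  ∑ N (λ a → u a * ∑ N λ b → u b * ∑ N λ c → u c * count a b c) ∎
  where
  open ≡-Reasoning
  F G H : ℕ → ℕ → ℕ
  F k a = u a * ⟦ a ∣? suc k ⟧
  G k b = u b * ⟦ b ∣? ∣ suc k - h ∣ ⟧
  H k c = u c * ⟦ c ∣? suc k + h ⟧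
  count : ℕ → ℕ → ℕ → ℕ
  count a b c = ∑ x λ k → ⟦ triple? h a b c k ⟧
  expand : ∀ k → ∑ N (F k) * ∑ N (G k) * ∑ N (H k) ≡ ∑ N (λ a → ∑ N λ b → ∑ N λ c → F k a * (G k b * H k c))
  expand k = begin
    ∑ N (F k) * ∑ N (G k) * ∑ N (H k)
      ≡⟨ *-assoc (∑ N (F k)) _ _ ⟩
    ∑ N (F k) * (∑ N (G k) * ∑ N (H k))
      ≡⟨ cong (∑ N (F k) *_) (∑-product N (G k) (H k)) ⟩
    ∑ N (F k) * ∑ N (λ b → ∑ N λ c → G k b * H k c)
      ≡⟨ ∑-product N (F k) _ ⟩
    ∑ N (λ a → ∑ N λ b → F k a * ∑ N λ c → G k b * H k c)
      ≡⟨ ∑-cong N (λ a → ∑-cong N λ b → sym (∑-*ˡ N (F k a) _)) ⟩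
    ∑ N (λ a → ∑ N λ b → ∑ N λ c → F k a * (G k b * H k c)) ∎
  collect : ∀ a b c → ∑ x (λ k → F k a * (G k b * H k c)) ≡ u a * (u b * (u c * count a b c))
  collect a b c = begin
    ∑ x (λ k → F k a * (G k b * H k c))
      ≡⟨ ∑-cong x (λ k → trans
           (rearrange (u a) ⟦ a ∣? suc k ⟧ (u b) ⟦ b ∣? ∣ suc k - h ∣ ⟧ (u c) ⟦ c ∣? suc k + h ⟧)
           (cong (u a * (u b * u c) *_) (sym (trans (⟦⟧-× (a ∣? suc k) _)
             (cong (⟦ a ∣? suc k ⟧ *_) (⟦⟧-× (b ∣? ∣ suc k - h ∣) (c ∣? suc k + h))))))) ⟩
    ∑ x (λ k → u a * (u b * u c) * ⟦ triple? h a b c k ⟧)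
      ≡⟨ ∑-*ˡ x (u a * (u b * u c)) _ ⟩
    u a * (u b * u c) * count a b c
      ≡⟨ reassoc (u a) (u b) (u c) (count a b c) ⟩
    u a * (u b * (u c * count a b c)) ∎
    where
    rearrange : ∀ p q r s t v → p * q * (r * s * (t * v)) ≡ p * (r * t) * (q * (s * v))
    rearrange = solve-∀
    reassoc : ∀ p q r s → p * (q * r) * s ≡ p * (q * (r * s))
    reassoc = solve-∀

-- `∑-harmonic` is applied to c, then b, then a, each time with the remaining variables multiplied
-- into f; each application gains M C.
∑-harmonic₃ : ∀ M C X (u : ℕ → ℕ) (Q : ℕ → ℕ → ℕ → ℕ) →
  (∀ i → i < M → ∑ (2 ^ i) (λ r → u (2 ^ i + r)) ≤ C * 2 ^ i) → u 0 ≡ 0 →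
  (∀ a b c → a < 2 ^ M → b < 2 ^ M → c < 2 ^ M → Q a b c * (a * b * c) ≤ X) →
  ∑ (2 ^ M) (λ a → u a * ∑ (2 ^ M) λ b → u b * ∑ (2 ^ M) λ c → u c * Q a b c)
    ≤ M * (C * (M * (C * (M * (C * X)))))
∑-harmonic₃ M C X u Q block u0 Q≤ =
  ∑-harmonic M C X₂ u F₁ block (cong (_* F₁ 0) u0) λ a a< → begin
    F₁ a * a
      ≡⟨ ∑-*ʳ N a _ ⟨
    ∑ N (λ b → u b * F₂ a b * a)
      ≡⟨ ∑-cong N (λ b → *-assoc (u b) _ a) ⟩
    ∑ N (λ b → u b * (F₂ a b * a))
      ≤⟨ ∑-harmonic M C X₁ u (λ b → F₂ a b * a) block (cong (_* (F₂ a 0 * a)) u0) (λ b b< → begin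
           F₂ a b * a * b
             ≡⟨ *-assoc (F₂ a b) a b ⟩
           F₂ a b * (a * b)
             ≡⟨ ∑-*ʳ N (a * b) _ ⟨
           ∑ N (λ c → u c * Q a b c * (a * b))
             ≡⟨ ∑-cong N (λ c → *-assoc (u c) _ (a * b)) ⟩
           ∑ N (λ c → u c * (Q a b c * (a * b)))
             ≤⟨ ∑-harmonic M C X u (λ c → Q a b c * (a * b)) block (cong (_* (Q a b 0 * (a * b))) u0) (λ c c< →
                  ≤-trans (≤-reflexive (*-assoc (Q a b c) (a * b) c)) (Q≤ a b c a< b< c<)) ⟩
           X₁ ∎) ⟩
    X₂ ∎
  where
  open ≤-Reasoning
  N X₁ X₂ : ℕ
  N  = 2 ^ M
  X₁ = M * (C * X)
  X₂ = M * (C * X₁)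
  F₂ : ℕ → ℕ → ℕ
  F₂ a b = ∑ N λ c → u c * Q a b c
  F₁ : ℕ → ℕ
  F₁ a = ∑ N λ b → u b * F₂ a b

S≤-from-majorant : ∀ M C X (w : ℕ → ℕ) h x → 0 < h →
  (∀ i → ∑ (2 ^ i) (λ r → w (2 ^ i + r)) ≤ C * 2 ^ i) →
  (∀ m → 0 < m → m < X → d m ≤ ∑ (2 ^ M) (λ δ → w δ * ⟦ δ ∣? m ⟧)) →
  2 ^ (3 * M) ≤ x → x + h < X →
  S x h ≤ M * (C * (M * (C * (M * (C * (suc (2 * (h * h) * h) * x))))))
S≤-from-majorant M C X w h x 0<h block maj 2^3M≤x x+h<X = begin
  S x h
    ≤⟨ sum-filter-suc-upTo (λ n → ¬? (n ≟ h)) (term h) x ⟩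
  ∑ x (λ k → term h (suc k))
    ≤⟨ ∑-mono x (λ k k<x → *-mono-≤
         (*-mono-≤ (maj₀ (suc k) (small k<x (m≤m+n (suc k) h)))
                   (maj₀ ∣ suc k - h ∣ (small k<x (≤-trans (∣m-n∣≤m⊔n (suc k) h) (m⊔n≤m+n (suc k) h)))))
         (maj₀ (suc k + h) (small k<x ≤-refl))) ⟩
  ∑ x (λ k → ∑ N (λ a → u a * ⟦ a ∣? suc k ⟧) * ∑ N (λ b → u b * ⟦ b ∣? ∣ suc k - h ∣ ⟧)
               * ∑ N (λ c → u c * ⟦ c ∣? suc k + h ⟧))
    ≡⟨ ∑-triple-majorant x N u h ⟩
  ∑ N (λ a → u a * ∑ N λ b → u b * ∑ N λ c → u c * ∑ x λ k → ⟦ triple? h a b c k ⟧)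
    ≤⟨ ∑-harmonic₃ M C _ u (λ a b c → ∑ x λ k → ⟦ triple? h a b c k ⟧) u-block u0
         (λ a b c a< b< c< → triple-count h a b c x 0<h (begin
           a * b * c          ≤⟨ *-mono-≤ (*-mono-≤ (<⇒≤ a<) (<⇒≤ b<)) (<⇒≤ c<) ⟩
           N * N * N          ≡⟨ cube N ⟩
           N ^ 3              ≡⟨ ^-*-assoc 2 M 3 ⟩
           2 ^ (M * 3)        ≡⟨ cong (2 ^_) (*-comm M 3) ⟩
           2 ^ (3 * M)        ≤⟨ 2^3M≤x ⟩
           x                  ∎)) ⟩
  M * (C * (M * (C * (M * (C * (suc (2 * (h * h) * h) * x)))))) ∎
  where
  open ≤-Reasoning
  N : ℕ
  N = 2 ^ M
  cube : ∀ y → y * y * y ≡ y * (y * (y * 1))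
  cube = solve-∀
  -- w with its value at 0 removed, as `∑-harmonic₃` asks for; no m > 0 has the divisor 0, so the
  -- majorant is unchanged.
  u : ℕ → ℕ
  u δ = ⟦ 0 <? δ ⟧ * w δ
  u0 : u 0 ≡ 0
  u0 = cong (_* w 0) (⟦⟧-no (0 <? 0) (<-irrefl refl))
  u-block : ∀ i → i < M → ∑ (2 ^ i) (λ r → u (2 ^ i + r)) ≤ C * 2 ^ i
  u-block i _ = ≤-trans (∑-mono (2 ^ i) λ r _ → ⟦⟧*-≤ (0 <? 2 ^ i + r) λ _ → ≤-refl) (block i)
  small : ∀ {k m} → k < x → m ≤ suc k + h → m < X
  small k<x m≤ = ≤-<-trans (≤-trans m≤ (+-monoˡ-≤ h k<x)) x+h<X
  maj₀ : ∀ m → m < X → d m ≤ ∑ N (λ δ → u δ * ⟦ δ ∣? m ⟧)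
  -- The second factor at n = h, a term let in when the filter was dropped: `d 0` reduces to 0.
  maj₀ zero    _  = z≤n
  maj₀ m@(suc _) m< = ≤-trans (maj m z<s m<) (∑-mono N λ δ _ → positive δ)
    where
    positive : ∀ δ → w δ * ⟦ δ ∣? m ⟧ ≤ u δ * ⟦ δ ∣? m ⟧
    positive zero = ≤-reflexive (trans
      (trans (cong (w 0 *_) 0∤m) (*-zeroʳ (w 0))) (sym (trans (cong (u 0 *_) 0∤m) (*-zeroʳ (u 0)))))
      where
      0∤m : ⟦ 0 ∣? m ⟧ ≡ 0
      0∤m = ⟦⟧-no (0 ∣? m) λ 0∣m → contradiction (∣⇒>0 z<s 0∣m) (<-irrefl refl)
    positive (suc δ) = *-monoˡ-≤ ⟦ suc δ ∣? m ⟧ (≤-reflexive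
      (trans (sym (*-identityˡ (w (suc δ)))) (cong (_* w (suc δ)) (sym (⟦⟧-yes (0 <? suc δ) z<s)))))

-- Choice of the parameters

-- With c = 12K and l = lg x this makes 3M = 12K · 2^s agree with log x up to a factor 2.
scale : ∀ c → .{{NonZero c}} → ∀ l → c ≤ l → ∃ λ s → c * 2 ^ s ≤ l × l < c * 2 ^ suc s
scale c l c≤l = lg q
  , ≤-trans (*-monoʳ-≤ c (2^lg≤n q (m≥n⇒m/n>0 c≤l))) (≤-trans (≤-reflexive (*-comm c q)) (m/n*n≤m l c))
  , (begin-strict
    l                    ≡⟨ m≡m%n+[m/n]*n l c ⟩
    l % c + q * c        <⟨ +-monoˡ-< (q * c) (m%n<n l c) ⟩
    c + q * c            ≡⟨ *-comm (suc q) c ⟩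
    c * suc q            ≤⟨ *-monoʳ-≤ c (n<2^[1+lg] q) ⟩
    c * 2 ^ suc (lg q)   ∎)
  where
  open ≤-Reasoning
  q : ℕ
  q = l / c

-- Stated for a variable k so that 2^(8k+1) is never evaluated.
S-bound : ∀ k → 7 ≤ k → (h : ℕ) → 1 ≤ h →
  ∃₂ λ (C N : ℕ) → (x : ℕ) → N ≤ x → S x h ≤ C * x * (⌊log₂ x ⌋ ^ 3)
S-bound k 7≤k h 1≤h with smooth-bound (suc (8 * k)) | divisor-bound (8 * suc (8 * k))
-- The term 2^(12K) gives lg x ≥ 12K, as `scale` requires, and h gives x + h ≤ 2x.
... | A , Ψ≤ | C , 0<C , d^K≤ = Cw * (Cw * Cw) * H , 2 ^ (12 * K) + h , bound
  where
  open ≤-Reasoning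
  K Cw H : ℕ
  -- K = 8β for β = 8k + 1, the least level j that the smooth number bound with base 2^β admits.
  K  = 8 * suc (8 * k)
  Cw = 2 ^ (4 * k) + 8 * (C * A)
  H  = suc (2 * (h * h) * h)
  bound : ∀ x → 2 ^ (12 * K) + h ≤ x → S x h ≤ Cw * (Cw * Cw) * H * x * lg x ^ 3
  bound x N≤x with scale (12 * K) (lg x) (2^k≤n⇒k≤lg {12 * K} (≤-trans (m≤m+n _ h) N≤x))
  ... | s , cs≤l , l<cs = begin
    S x h
      ≤⟨ S≤-from-majorant M w-const (2 ^ (k * M)) w h x 1≤h w-block majorant 2^3M≤x x+h< ⟩
    M * (Cw * (M * (Cw * (M * (Cw * (H * x))))))
      ≡⟨ rearrange M Cw H x ⟩
    Cw * (Cw * Cw) * H * x * M ^ 3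
      ≤⟨ *-monoʳ-≤ (Cw * (Cw * Cw) * H * x) (^-monoˡ-≤ 3 (≤-trans (m≤n*m M 3) 3M≤l)) ⟩
    Cw * (Cw * Cw) * H * x * lg x ^ 3 ∎
    where
    open Majorant k K C A s (s≤s z≤n) 0<C d^K≤ (λ j K≤j → Ψ≤ j (≤-trans (s≤s z≤n) K≤j) K≤j)
    rearrange : ∀ m c h x → m * (c * (m * (c * (m * (c * (h * x)))))) ≡ c * (c * c) * h * x * (m * (m * (m * 1)))
    rearrange = solve-∀
    12K2^s≡3M : 12 * K * 2 ^ s ≡ 3 * M
    12K2^s≡3M = regroup K (2 ^ s)
      where
      regroup : ∀ a b → 12 * a * b ≡ 3 * (4 * (a * b))
      regroup = solve-∀
    3M≤l : 3 * M ≤ lg x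
    3M≤l = ≤-trans (≤-reflexive (sym 12K2^s≡3M)) cs≤l
    0<x : 0 < x
    0<x = ≤-trans 1≤h (≤-trans (m≤n+m h (2 ^ (12 * K))) N≤x)
    2^3M≤x : 2 ^ (3 * M) ≤ x
    2^3M≤x = ≤-trans (^-monoʳ-≤ 2 3M≤l) (2^lg≤n x 0<x)
    l<6M : lg x < 6 * M
    l<6M = ≤-trans l<cs (≤-reflexive (trans (regroup K (2 ^ s)) refl))
      where
      regroup : ∀ a b → 12 * a * (2 * b) ≡ 6 * (4 * (a * b))
      regroup = solve-∀
    1≤M : 1 ≤ M
    1≤M = *-mono-≤ {1} {4} (s≤s z≤n) (*-mono-≤ {1} {K} (s≤s z≤n) (m^n>0 2 s))
    -- lg x < 6M gives x < 2^(6M), and doubling costs at most one more M; this is the origin of 7 ≤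
    -- k.
    x+h< : x + h < 2 ^ (k * M)
    x+h< = begin-strict
      x + h                     ≤⟨ +-monoʳ-≤ x (≤-trans (m≤n+m h (2 ^ (12 * K))) N≤x) ⟩
      x + x                     <⟨ +-mono-< x<2^6M x<2^6M ⟩
      2 ^ (6 * M) + 2 ^ (6 * M) ≡⟨ 2^-double (6 * M) ⟨
      2 ^ suc (6 * M)           ≤⟨ ^-monoʳ-≤ 2 (+-monoˡ-≤ (6 * M) 1≤M) ⟩
      2 ^ (7 * M)               ≤⟨ ^-monoʳ-≤ 2 (*-monoˡ-≤ M 7≤k) ⟩
      2 ^ (k * M)               ∎
      where
      x<2^6M : x < 2 ^ (6 * M)
      x<2^6M = <-≤-trans (n<2^[1+lg] x) (^-monoʳ-≤ 2 l<6M)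

theorem1p2 : (h : ℕ) → 1 ≤ h →
    ∃₂ λ (C N : ℕ) → (x : ℕ) → N ≤ x →
    S x h ≤ C * x * (⌊log₂ x ⌋ ^ 3)
theorem1p2 = S-bound 7 ≤-refl
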